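{- For every partition $\lambda$, the formal power series \[ C_\lambda(X;q,t)=\sum_{\sigma:\mathrm{dg}(\lambda)\to\mathbb{Z}_{>0}}q^{\mathrm{maj}(\sigma)}t^{\mathrm{quinv}(\sigma)}x^\sigma \] is symmetric in the variables $x_1,x_2,\dots$.
   Context: Let $\lambda=(\lambda_1\ge\dots\ge\lambda_k>0)$ be a partition. Its diagram is $\mathrm{dg}(\lambda)=\{(r,i):1\le i\le k,\ 1\le r\le\lambda_i\}$, drawn as $k$ bottom-justified columns, column $i$ (counted from the left) having $\lambda_i$ cells; $(r,i)$ is the cell in row $r$ (rows numbered from bottom to top) and column $i$. A filling is a map $\sigma:\mathrm{dg}(\lambda)\to\mathbb{Z}_{>0}$, and $x^\sigma=\prod_{u\in\mathrm{dg}(\lambda)}x_{\sigma(u)}$. For a cell $u=(r,i)$ with $r>1$ put $\mathrm{South}(u)=(r-1,i)$, and let $\mathrm{leg}(u)=\lambda_i-r$. Then $\mathrm{maj}(\sigma)=\sum(\mathrm{leg}(u)+1)$, the sum over cells $u=(r,i)$ with $r>1$ and $\sigma(u)>\sigma(\mathrm{South}(u))$. A triple is either three cells $(r+1,i),(r,i),(r,j)$ of $\mathrm{dg}(\lambda)$ with $i<j$, or (a degenerate triple) two cells $(r,i),(r,j)$ with $i<j$ and $\lambda_i=r$. Put $a=\sigma((r+1,i))$ (with $a=0$ for a degenerate triple), $b=\sigma((r,i))$, $c=\sigma((r,j))$. The triple is a quinv triple iff $a<b<c$, or $b<c<a$, or $c<b<a$, or $a=b\neq c$. $\mathrm{quinv}(\sigma)$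 is the number of quinv triples of $\sigma$.
   Formalization: The third strict case of a quinv triple is taken as c<a<b (cyclic rotations of a<b<c) instead of the printed c<b<a, for which symmetry fails: for λ=(2,2) the coefficients of x1²x2x3 and x1x2x3² have constant terms 2 and 1. -}

module Defs where

open import Data.Fin using (Fin; zero; suc; toℕ; fromℕ<; inject₁) renaming (_<_ to _<ᶠ_)
open import Data.Fin.Properties using () renaming (_<?_ to _<ᶠ?_)
open import Data.List using (List; []; _∷_; _++_; map; filter; length; concatMap; cartesianProduct; cartesianProductWith; allFin; upTo; [_])
open import Data.List.Membership.Propositional using (_∈_)
open import Data.List.Membership.Propositional.Properties using (∈-∃++; ∈-map⁺; ∈-upTo⁺; ∈-allFin; ∈-concat⁺′; ∈-cartesianProductWith⁺)
open import Data.List.Properties using (filter-≐)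
open import Data.List.Relation.Binary.Permutation.Propositional using (_↭_; refl; prep; swap; trans; ↭-refl; ↭-sym; ↭-trans)
open import Data.List.Relation.Binary.Permutation.Propositional.Properties using (¬x∷xs↭[]; shift; drop-mid; ∈-resp-↭; map⁺)
open import Data.List.Relation.Unary.Any using (here; there)
open import Data.List.Relation.Unary.AllPairs using ([]; _∷_)
open import Data.List.Relation.Unary.All using ([])
open import Data.List.Relation.Unary.Unique.Propositional using (Unique)
open import Data.List.Relation.Unary.Unique.Propositional.Properties using (cartesianProductWith⁺; upTo⁺) renaming (map⁺ to Unique-map⁺)
open import Data.Maybe using (Maybe; just; nothing; maybe′) renaming (map to mapMaybe)
open import Data.Nat using (ℕ; zero; suc; _+_; _∸_; _⊔_; _<_; _≤_; _≥_; _>_; _<?_)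
open import Data.Nat.ListAction using (sum)
open import Data.Nat.Properties using (_≟_; m≤m⊔n; m≤n⊔m; ≤-trans; ⊔-comm; ⊔-assoc)
open import Data.Product using (Σ-syntax; _×_; _,_; proj₁)
open import Data.Sum using (_⊎_)
open import Data.Vec using (Vec; []; _∷_; lookup)
open import Data.Vec.Relation.Unary.All using (All; []; _∷_)
open import Data.Vec.Relation.Unary.All.Properties using (lookup⁺)
open import Data.Vec.Relation.Unary.Linked using (Linked)
open import Function using (_↔_; Inverse)
open import Relation.Binary.Definitions using (DecidableEquality)
open import Relation.Binary.PropositionalEquality as ≡ using (_≡_; _≢_; refl; cong)
open import Relation.Nullary using (Dec; yes; no)
open import Relation.Nullary.Decidable using (map′; _×-dec_; _⊎-dec_; ¬?)

-- 1+ n is the positive integer n + 1.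
record ℤ⁺ : Set where
  constructor 1+_
  field
    pred : ℕ

value : ℤ⁺ → ℕ
value (1+ n) = suc n

_≟⁺_ : DecidableEquality ℤ⁺
(1+ m) ≟⁺ (1+ n) = map′ (cong 1+_) (cong ℤ⁺.pred) (m ≟ n)

open import Data.List.Membership.DecPropositional _≟⁺_ using (_∈?_)

------------------------------------------------------------------------
-- Formal power series in q, t, x₁, x₂, …

-- A monomial in the x's is the list of the indices of its variables, with
-- multiplicity; two lists denote the same monomial iff they are related by _↭_.
Monomial : Set
Monomial = List ℤ⁺

_↭?_ : (u v : Monomial) → Dec (u ↭ v)
[]      ↭? []      = yes ↭-refl
[]      ↭? (_ ∷ _) = no λ p → ¬x∷xs↭[] (↭-sym p)
(x ∷ u) ↭? v with x ∈? v
... | no  x∉v = no λ p → x∉v (∈-resp-↭ p (here refl))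
... | yes x∈v with ∈-∃++ x∈v
...   | as , bs , refl =
        map′ (λ p → ↭-trans (prep x p) (↭-sym (shift x as bs)))
             (drop-mid [] as)
             (u ↭? (as ++ bs))

-- coeff F m n w is the coefficient of q^m t^n x^w in F.
record PowerSeries : Set where
  field
    coeff      : ℕ → ℕ → Monomial → ℕ
    coeff-cong : ∀ m n {v w} → v ↭ w → coeff m n v ≡ coeff m n w

open PowerSeries public

_≈_ : PowerSeries → PowerSeries → Set
F ≈ G = ∀ m n w → coeff F m n w ≡ coeff G m n w

-- The substitution x_i ↦ x_{π(i)}: the coefficient of x^w in the result is
-- the coefficient of x^{π⁻¹(w)} in F.
permuteVars : ℤ⁺ ↔ ℤ⁺ → PowerSeries → PowerSeries
permuteVars π F = record
  { coeff      = λ m n w → coeff F m n (map (Inverse.from π) w)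
  ; coeff-cong = λ m n v↭w → coeff-cong F m n (map⁺ (Inverse.from π) v↭w)
  }

Symmetric : PowerSeries → Set
Symmetric F = (π : ℤ⁺ ↔ ℤ⁺) → permuteVars π F ≈ F

------------------------------------------------------------------------
-- Partitions, diagrams, fillings

record Partition : Set where
  field
    {numParts} : ℕ
    parts      : Vec ℕ numParts
    decreasing : Linked _≥_ parts
    positive   : All (_> 0) parts

open Partition public

-- The strict cases are the three rotations of a < b < c.  The variant with
-- c < b < a as third case does not give a symmetric series: for the partition
-- (2,2) the coefficients of x₁²x₂x₃ and x₁x₂x₃² then have constant terms 2 and 1.
QuinvCondition : ℕ → ℕ → ℕ → Set
QuinvCondition a b c =
  (a < b × b < c) ⊎ (b < c × c < a) ⊎ (c < a × a < b) ⊎ (a ≡ b × b ≢ c)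

quinvCondition? : ∀ a b c → Dec (QuinvCondition a b c)
quinvCondition? a b c =
  ((a <? b) ×-dec (b <? c)) ⊎-dec ((b <? c) ×-dec (c <? a)) ⊎-dec
  ((c <? a) ×-dec (a <? b)) ⊎-dec ((a ≟ b) ×-dec ¬? (b ≟ c))

module _ (μ : Partition) where

  -- (i , r) is the cell in column toℕ i + 1 and row toℕ r + 1.
  Cell : Set
  Cell = Σ[ i ∈ Fin (numParts μ) ] Fin (lookup (parts μ) i)

  dg : List Cell
  dg = concatMap (λ i → map (i ,_) (allFin (lookup (parts μ) i))) (allFin (numParts μ))

  -- A map from cells to ℤ⁺, tabulated column by column (each from bottom to
  -- top) so that pointwise equal fillings are propositionally equal.
  Filling : Set
  Filling = All (Vec ℤ⁺) (parts μ)

  col : Cell → Fin (numParts μ)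
  col = proj₁

  row : Cell → ℕ
  row (_ , r) = suc (toℕ r)

  leg : Cell → ℕ
  leg u = lookup (parts μ) (col u) ∸ row u

  South : Cell → Maybe Cell
  South (i , r) = mapMaybe (i ,_) (lower r)
    where
    lower : ∀ {h} → Fin h → Maybe (Fin h)
    lower zero    = nothing
    lower (suc s) = just (inject₁ s)

  North : Cell → Maybe Cell
  North (i , r) with suc (toℕ r) <? lookup (parts μ) i
  ... | yes r+1<h = just (i , fromℕ< r+1<h)
  ... | no  _     = nothing

  -- Every pair of cells (r,i), (r,j) with i < j belongs to exactly one triple:
  -- an ordinary one if (r+1,i) is a cell, and otherwise, i.e. if r is the height
  -- of column i, a degenerate one.
  IsTriple : Cell × Cell → Set
  IsTriple (u , v) = row u ≡ row v × col u <ᶠ col v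

  isTriple? : ∀ p → Dec (IsTriple p)
  isTriple? (u , v) = (row u ≟ row v) ×-dec (col u <ᶠ? col v)

  triples : List (Cell × Cell)
  triples = filter isTriple? (cartesianProduct dg dg)

  _at_ : Filling → Cell → ℤ⁺
  σ at (i , r) = lookup (lookup⁺ σ i) r

  -- The value at a possibly absent cell, which counts as 0.
  _at₀_ : Filling → Maybe Cell → ℕ
  σ at₀ u? = maybe′ (λ u → value (σ at u)) 0 u?

  xMonomial : Filling → Monomial
  xMonomial σ = map (σ at_) dg

  majAt : Filling → Cell → ℕ
  majAt σ u with South u
  ... | nothing = 0
  ... | just v with value (σ at v) <? value (σ at u)
  ...   | yes _ = leg u + 1
  ...   | no  _ = 0

  maj : Filling → ℕ
  maj σ = sum (map (majAt σ) dg)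

  IsQuinvTriple : Filling → Cell × Cell → Set
  IsQuinvTriple σ (u , v) =
    QuinvCondition (σ at₀ North u) (value (σ at u)) (value (σ at v))

  isQuinvTriple? : ∀ σ p → Dec (IsQuinvTriple σ p)
  isQuinvTriple? σ (u , v) =
    quinvCondition? (σ at₀ North u) (value (σ at u)) (value (σ at v))

  quinv : Filling → ℕ
  quinv σ = length (filter (isQuinvTriple? σ) triples)

------------------------------------------------------------------------
-- Enumeration of fillings with bounded entries

columns : List ℤ⁺ → (h : ℕ) → List (Vec ℤ⁺ h)
columns as zero    = [ [] ]
columns as (suc h) = cartesianProductWith _∷_ as (columns as h)

tables : List ℤ⁺ → ∀ {k} (hs : Vec ℕ k) → List (All (Vec ℤ⁺) hs)
tables as []       = [ [] ]
tables as (h ∷ hs) = cartesianProductWith _∷_ (columns as h) (tables as hs)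

fillingsUpTo : ℕ → (μ : Partition) → List (Filling μ)
fillingsUpTo N μ = tables (map 1+_ (upTo N)) (parts μ)

maxIndex : Monomial → ℕ
maxIndex []      = 0
maxIndex (i ∷ w) = value i ⊔ maxIndex w

maxIndex-cong : ∀ {v w} → v ↭ w → maxIndex v ≡ maxIndex w
maxIndex-cong refl          = refl
maxIndex-cong (prep i p)    = cong (value i ⊔_) (maxIndex-cong p)
maxIndex-cong (swap {v} {w} i j p) rewrite maxIndex-cong p =
  ≡.trans (≡.sym (⊔-assoc (value i) (value j) (maxIndex w)))
    (≡.trans (cong (_⊔ maxIndex w) (⊔-comm (value i) (value j)))
      (⊔-assoc (value j) (value i) (maxIndex w)))
maxIndex-cong (trans p p′)  = ≡.trans (maxIndex-cong p) (maxIndex-cong p′)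

------------------------------------------------------------------------
-- The series C_μ

module _ (μ : Partition) where

  HasTerm : ℕ → ℕ → Monomial → Filling μ → Set
  HasTerm m n w σ = maj μ σ ≡ m × quinv μ σ ≡ n × xMonomial μ σ ↭ w

  hasTerm? : ∀ m n w σ → Dec (HasTerm m n w σ)
  hasTerm? m n w σ = (maj μ σ ≟ m) ×-dec (quinv μ σ ≟ n) ×-dec (xMonomial μ σ ↭? w)

-- The coefficient of q^m t^n x^w is the number of fillings σ with
-- q^maj(σ) t^quinv(σ) x^σ = q^m t^n x^w.  The entries of such a σ are at most
-- maxIndex w, so no filling is missed (∈-fillingsUpTo) or counted twice
-- (fillingsUpTo-unique).
C : Partition → PowerSeries
C μ = record
  { coeff      = λ m n w → length (filter (hasTerm? μ m n w) (fillingsUpTo (maxIndex w) μ))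
  ; coeff-cong = λ m n {v} {w} v↭w → cong length (≡.trans
      (cong (λ N → filter (hasTerm? μ m n v) (fillingsUpTo N μ)) (maxIndex-cong v↭w))
      (filter-≐ (hasTerm? μ m n v) (hasTerm? μ m n w)
        ( (λ (p , p′ , σ↭v) → p , p′ , ↭-trans σ↭v v↭w)
        , (λ (p , p′ , σ↭w) → p , p′ , ↭-trans σ↭w (↭-sym v↭w)))
        (fillingsUpTo (maxIndex w) μ)))
  }

∈-columns : ∀ {as h} (c : Vec ℤ⁺ h) → (∀ r → lookup c r ∈ as) → c ∈ columns as h
∈-columns []      _ = here refl
∈-columns (a ∷ c) p =
  ∈-cartesianProductWith⁺ _∷_ (p zero) (∈-columns c (λ r → p (suc r)))

∈-tables : ∀ {as k} {hs : Vec ℕ k} (T : All (Vec ℤ⁺) hs) →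
           (∀ i r → lookup (lookup⁺ T i) r ∈ as) → T ∈ tables as hs
∈-tables []      _ = here refl
∈-tables (c ∷ T) p =
  ∈-cartesianProductWith⁺ _∷_ (∈-columns c (p zero)) (∈-tables T (λ i → p (suc i)))

∈-maxIndex : ∀ {i w} → i ∈ w → value i ≤ maxIndex w
∈-maxIndex {w = j ∷ w} (here refl) = m≤m⊔n (value j) (maxIndex w)
∈-maxIndex {w = j ∷ w} (there p)   = ≤-trans (∈-maxIndex p) (m≤n⊔m (value j) (maxIndex w))

∈-fillingsUpTo : ∀ {μ} (σ : Filling μ) {w} → xMonomial μ σ ↭ w → σ ∈ fillingsUpTo (maxIndex w) μ
∈-fillingsUpTo {μ} σ σ↭w = ∈-tables σ λ i r →
  ∈-map⁺ 1+_ (∈-upTo⁺ (∈-maxIndex (∈-resp-↭ σ↭w (∈-map⁺ (_at_ μ σ) (∈-dg i r)))))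
  where
  ∈-dg : ∀ i r → (i , r) ∈ dg μ
  ∈-dg i r = ∈-concat⁺′ (∈-map⁺ (i ,_) (∈-allFin r))
    (∈-map⁺ (λ j → map (j ,_) (allFin (lookup (parts μ) j))) (∈-allFin i))

columns-unique : ∀ {as} → Unique as → ∀ h → Unique (columns as h)
columns-unique as! zero    = [] ∷ []
columns-unique as! (suc h) =
  cartesianProductWith⁺ _∷_ (λ { refl → refl , refl }) as! (columns-unique as! h)

tables-unique : ∀ {as} → Unique as → ∀ {k} (hs : Vec ℕ k) → Unique (tables as hs)
tables-unique as! []       = [] ∷ []
tables-unique as! (h ∷ hs) =
  cartesianProductWith⁺ _∷_ (λ { refl → refl , refl }) (columns-unique as! h) (tables-unique as! hs)

fillingsUpTo-unique : ∀ N μ → Unique (fillingsUpTo N μ)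
fillingsUpTo-unique N μ =
  tables-unique (Unique-map⁺ (cong ℤ⁺.pred) (upTo⁺ N)) (parts μ)

{-# OPTIONS --safe #-}
-- Let k be the number of columns and read the cells row by row, the cell (r , i)
-- having position r k + i.  Then quinv + (arms of the descents) counts the pairs
-- of cells at distance less than k whose entries increase, while maj and the
-- arms are sums over the increasing pairs at distance exactly k.  So C is a sum
-- over fillings of a product of weights of increasing pairs: t at distance less
-- than k, an arbitrary weight (depending on the pair) at distance k, and 1 beyond.
--
-- It suffices to exchange two adjacent letters, and the cells with other entries
-- cannot tell these apart, so let there be only two letters.  The weight of a
-- pair (u , v) at distance k matters only if u has the smaller and v the larger
-- letter.  Then every other cell contributes the same whatever its letter is, so
-- these fillings reduce to those of the diagram without u and v.  Hence changing
-- this weight to 1 does not affect the symmetry.  When all weights at distance k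
-- are 1, the pairs at distance k - 1 are in turn the outermost ones, and finally
-- all weights are 1, where the symmetry is clear.
module Submission where

open import Defs
open import Algebra.Bundles using (CommutativeSemigroup; Monoid)
import Algebra.Properties.CommutativeSemigroup as CommutativeSemigroupProperties
open import Algebra.Structures using (IsCommutativeMonoid)
open import Data.Bool using (Bool; true; false; if_then_else_; _∧_)
open import Data.Empty using (⊥-elim)
open import Data.Fin using (Fin; zero; suc; toℕ; inject₁) renaming (_<_ to _<ᶠ_)
import Data.Fin.Properties as Fin
open import Data.List using (List; []; _∷_; _++_; map; concat; tabulate; replicate; filter; length; cartesianProduct; cartesianProductWith; allFin; upTo)
open import Data.List.Membership.Propositional using (_∈_; find; lose)
open import Data.List.Membership.Propositional.Properties using (∈-∃++; ∈-map⁺; ∈-map⁻; ∈-allFin; ∈-concat⁺′; ∈-upTo⁺; ∈-filter⁺; ∈-filter⁻)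
open import Data.List.Membership.Propositional.Properties.WithK using (unique∧set⇒bag)
open import Data.List.Properties using (map-tabulate; tabulate-cong; concat-map; map-++; map-∘; map-cong; map-cong-local; map-id; map-replicate)
open import Data.List.Relation.Binary.BagAndSetEquality using (∼bag⇒↭)
open import Data.List.Relation.Binary.Disjoint.Propositional using (Disjoint)
open import Data.List.Relation.Binary.Permutation.Propositional using (_↭_; refl; prep; swap; ↭-refl; ↭-sym; ↭-trans; ↭-reflexive; ↭⇒↭ₛ) renaming (trans to transitive)
open import Data.List.Relation.Binary.Permutation.Propositional.Properties using (shift; ↭-length; ∈-resp-↭; map⁺; ++⁺ˡ; ++-comm)
open import Data.List.Relation.Binary.Permutation.Setoid.Properties using (AllPairs-resp-↭; Unique-resp-↭)
open import Data.List.Relation.Binary.Sublist.Propositional using (_⊆_; []; _∷_; _∷ʳ_)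
open import Data.List.Relation.Binary.Sublist.Propositional.Properties using (All-resp-⊆)
open import Data.List.Relation.Unary.All as All using (All; []; _∷_)
import Data.List.Relation.Unary.All.Properties as All
open import Data.List.Relation.Unary.AllPairs as AllPairs using (AllPairs; []; _∷_)
import Data.List.Relation.Unary.AllPairs.Properties as AllPairs
open import Data.List.Relation.Unary.Any using (here; there; any?)
open import Data.List.Relation.Unary.Unique.Propositional using (Unique)
open import Data.List.Relation.Unary.Unique.Propositional.Properties as Unique using ()
open import Data.Maybe using (Maybe; just; nothing; maybe; maybe′) renaming (map to mapMaybe)
open import Data.Nat using (ℕ; zero; suc; _+_; _*_; _∸_; _⊔_; _<_; _>_; _≤_; _≤′_; ≤′-refl; ≤′-step; z≤n; s≤s⁻¹; _<?_)
open import Data.Nat.ListAction using (sum)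
open import Data.Nat.Properties
open import Data.Nat.Solver using (module +-*-Solver)
open import Data.Product using (_×_; _,_; proj₁; proj₂; ∃-syntax)
open import Data.Sum using (_⊎_; inj₁; inj₂; [_,_]′)
open import Data.Vec using (Vec; []; _∷_; lookup)
open import Data.Vec.Relation.Unary.All using ([]; _∷_)
open import Data.Vec.Relation.Unary.All.Properties using (lookup⁺)
open import Data.Vec.Relation.Unary.Linked using ([-])
open import Function using (_∘_; id; case_of_; _⇔_; mk⇔; Inverse)
open import Level using (0ℓ)
open import Relation.Binary.Definitions using (Tri; tri<; tri≈; tri>)
open import Relation.Binary.PropositionalEquality
open import Relation.Nullary using (¬_; Dec; yes; no; does)
open import Relation.Nullary.Decidable using (dec-true; dec-false; does-⇔; _×-dec_)
open import Relation.Unary using (Decidable)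
import Tactic.MonoidSolver as MonoidSolver

-- Sums over lists and over assignments

module Sums {M : Set} {_∙_ : M → M → M} {ε : M} (isCM : IsCommutativeMonoid _≡_ _∙_ ε) where

  open IsCommutativeMonoid isCM using (assoc; identityˡ; comm; isCommutativeSemigroup)

  private
    commutativeSemigroup : CommutativeSemigroup 0ℓ 0ℓ
    commutativeSemigroup = record { isCommutativeSemigroup = isCommutativeSemigroup }

  open CommutativeSemigroupProperties commutativeSemigroup using (interchange; x∙yz≈y∙xz)

  ∑ : {A : Set} → List A → (A → M) → M
  ∑ []       f = ε
  ∑ (x ∷ xs) f = f x ∙ ∑ xs f

  module _ {A : Set} where

    ∑-cong : ∀ {f g : A → M} xs → (∀ {x} → x ∈ xs → f x ≡ g x) → ∑ xs f ≡ ∑ xs g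
    ∑-cong []       f≡g = refl
    ∑-cong (x ∷ xs) f≡g = cong₂ _∙_ (f≡g (here refl)) (∑-cong xs (f≡g ∘ there))

    ∑-ε : ∀ {f : A → M} xs → (∀ {x} → x ∈ xs → f x ≡ ε) → ∑ xs f ≡ ε
    ∑-ε []       f≡ε = refl
    ∑-ε (x ∷ xs) f≡ε = trans (cong₂ _∙_ (f≡ε (here refl)) (∑-ε xs (f≡ε ∘ there))) (identityˡ ε)

    ∑-∙ : ∀ (f g : A → M) xs → ∑ xs (λ x → f x ∙ g x) ≡ ∑ xs f ∙ ∑ xs g
    ∑-∙ f g []       = sym (identityˡ ε)
    ∑-∙ f g (x ∷ xs) = trans (cong ((f x ∙ g x) ∙_) (∑-∙ f g xs)) (interchange _ _ _ _)

    ∑-↭ : ∀ (f : A → M) {xs ys} → xs ↭ ys → ∑ xs f ≡ ∑ ys f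
    ∑-↭ f refl         = refl
    ∑-↭ f (prep x p)   = cong (f x ∙_) (∑-↭ f p)
    ∑-↭ f (swap x y p) = trans (cong (λ s → f x ∙ (f y ∙ s)) (∑-↭ f p)) (x∙yz≈y∙xz _ _ _)
    ∑-↭ f (transitive p q) = trans (∑-↭ f p) (∑-↭ f q)

    ∑-++ : ∀ (f : A → M) xs ys → ∑ (xs ++ ys) f ≡ ∑ xs f ∙ ∑ ys f
    ∑-++ f []       ys = sym (identityˡ _)
    ∑-++ f (x ∷ xs) ys = trans (cong (f x ∙_) (∑-++ f xs ys)) (sym (assoc _ _ _))

  ∑-map : ∀ {A B : Set} (g : A → B) (f : B → M) xs → ∑ (map g xs) f ≡ ∑ xs (f ∘ g)
  ∑-map g f []       = refl
  ∑-map g f (x ∷ xs) = cong (f (g x) ∙_) (∑-map g f xs)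

  ∑-comm : ∀ {A B : Set} (f : A → B → M) xs ys →
           ∑ xs (λ x → ∑ ys (f x)) ≡ ∑ ys (λ y → ∑ xs (λ x → f x y))
  ∑-comm f []       ys = sym (∑-ε ys (λ _ → refl))
  ∑-comm f (x ∷ xs) ys = trans (cong (∑ ys (f x) ∙_) (∑-comm f xs ys)) (sym (∑-∙ _ _ ys))

  -- Each unordered pair of entries contributes in both orders, so the value does not depend on the
  -- order of the list. This is what later allows chosen cells to be moved to the front.
  pairSum : {A : Set} → (A → A → M) → List A → M
  pairSum g []       = ε
  pairSum g (x ∷ xs) = ∑ xs (λ y → g x y ∙ g y x) ∙ pairSum g xs

  module _ {A : Set} where

    pairSum-cong : ∀ {f g : A → A → M} xs → (∀ {x y} → x ∈ xs → y ∈ xs → f x y ≡ g x y) →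
                   pairSum f xs ≡ pairSum g xs
    pairSum-cong []       f≡g = refl
    pairSum-cong (x ∷ xs) f≡g = cong₂ _∙_
      (∑-cong xs (λ y∈ → cong₂ _∙_ (f≡g (here refl) (there y∈)) (f≡g (there y∈) (here refl))))
      (pairSum-cong xs (λ x∈ y∈ → f≡g (there x∈) (there y∈)))

    pairSum-∙ : ∀ (f g : A → A → M) xs →
                pairSum (λ x y → f x y ∙ g x y) xs ≡ pairSum f xs ∙ pairSum g xs
    pairSum-∙ f g []       = sym (identityˡ ε)
    pairSum-∙ f g (x ∷ xs) = trans
      (cong₂ _∙_ (trans (∑-cong xs (λ _ → interchange _ _ _ _)) (∑-∙ _ _ xs)) (pairSum-∙ f g xs))
      (interchange _ _ _ _)

    pairSum-↭ : ∀ (g : A → A → M) {xs ys} → xs ↭ ys → pairSum g xs ≡ pairSum g ys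
    pairSum-↭ g refl        = refl
    pairSum-↭ g (prep x p)  = cong₂ _∙_ (∑-↭ _ p) (pairSum-↭ g p)
    pairSum-↭ g (transitive p q) = trans (pairSum-↭ g p) (pairSum-↭ g q)
    pairSum-↭ g (swap {xs} {ys} x y p) = trans
      (cong₂ (λ s r → ((g x y ∙ g y x) ∙ s) ∙ r) (∑-↭ _ p) (cong₂ _∙_ (∑-↭ _ p) (pairSum-↭ g p)))
      (trans (assoc _ _ _) (trans (cong₂ _∙_ (comm _ _) (x∙yz≈y∙xz _ _ _)) (sym (assoc _ _ _))))

    pairSum-drop : ∀ {g : A → A → M} xs ys →
                   (∀ {x} y → x ∈ xs → g x y ≡ ε × g y x ≡ ε) → pairSum g (xs ++ ys) ≡ pairSum g ys
    pairSum-drop []       ys g≡ε = refl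
    pairSum-drop (x ∷ xs) ys g≡ε = trans
      (cong₂ _∙_
        (∑-ε (xs ++ ys) (λ {y} _ → trans (cong₂ _∙_ (proj₁ (g≡ε y (here refl))) (proj₂ (g≡ε y (here refl)))) (identityˡ ε)))
        (pairSum-drop xs ys (λ y x∈ → g≡ε y (there x∈))))
      (identityˡ _)

    pairSum-diagonal : ∀ (g : A → A → M) → (∀ x → g x x ≡ ε) → ∀ xs →
                       pairSum g xs ≡ ∑ xs (λ x → ∑ xs (g x))
    pairSum-diagonal g gxx≡ε []       = refl
    pairSum-diagonal g gxx≡ε (x ∷ xs) = trans
      (cong₂ _∙_ (∑-∙ _ _ xs) (pairSum-diagonal g gxx≡ε xs))
      (trans (assoc _ _ _) (cong₂ _∙_
        (sym (trans (cong (_∙ ∑ xs (g x)) (gxx≡ε x)) (identityˡ _)))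
        (sym (∑-∙ (λ y → g y x) (λ y → ∑ xs (g y)) xs))))

  pairSum-map : ∀ {A B : Set} (h : A → B) (g : B → B → M) xs →
                pairSum g (map h xs) ≡ pairSum (λ x y → g (h x) (h y)) xs
  pairSum-map h g []       = refl
  pairSum-map h g (x ∷ xs) = cong₂ _∙_ (∑-map h _ xs) (pairSum-map h g xs)

open Sums +-0-isCommutativeMonoid using () renaming
  ( ∑ to ∑ℕ; ∑-cong to ∑ℕ-cong; ∑-ε to ∑ℕ-0; ∑-∙ to ∑ℕ-+; ∑-↭ to ∑ℕ-↭; ∑-++ to ∑ℕ-++; ∑-map to ∑ℕ-map; ∑-comm to ∑ℕ-comm )

-- A list of pairs rather than a function on a fixed diagram: the induction removes arbitrary cells,
-- and those that remain need not form a diagram.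
Assignment : Set → Set → Set
Assignment X A = List (X × A)

assignmentSum : {X A : Set} → List A → List X → (Assignment X A → ℕ) → ℕ
assignmentSum L []       h = h []
assignmentSum L (p ∷ ps) h = ∑ℕ L (λ x → assignmentSum L ps (λ σ → h ((p , x) ∷ σ)))

Invariant : {A : Set} → (List A → ℕ) → Set
Invariant h = ∀ {σ τ} → σ ↭ τ → h σ ≡ h τ

module _ {X A : Set} (L : List A) where

  private S = assignmentSum {X} L

  assignmentSum-cong : ∀ ps {h h′} → (∀ σ → map proj₁ σ ≡ ps → h σ ≡ h′ σ) → S ps h ≡ S ps h′
  assignmentSum-cong []       h≡h′ = h≡h′ [] refl
  assignmentSum-cong (p ∷ ps) h≡h′ =
    ∑ℕ-cong L (λ _ → assignmentSum-cong ps (λ σ eq → h≡h′ _ (cong (p ∷_) eq)))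

  assignmentSum-+ : ∀ ps h h′ → S ps (λ σ → h σ + h′ σ) ≡ S ps h + S ps h′
  assignmentSum-+ []       h h′ = refl
  assignmentSum-+ (p ∷ ps) h h′ =
    trans (∑ℕ-cong L (λ _ → assignmentSum-+ ps _ _)) (∑ℕ-+ _ _ L)

  assignmentSum-++ : ∀ ps qs h → S (ps ++ qs) h ≡ S ps (λ σ → S qs (λ τ → h (σ ++ τ)))
  assignmentSum-++ []       qs h = refl
  assignmentSum-++ (p ∷ ps) qs h = ∑ℕ-cong L (λ _ → assignmentSum-++ ps qs _)

  -- Adjacent summations may be exchanged by `∑ℕ-comm`; invariance of `h` absorbs the resulting
  -- reordering of the assignment.
  assignmentSum-↭ : ∀ {ps qs} → ps ↭ qs → ∀ {h} → Invariant h → S ps h ≡ S qs h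
  assignmentSum-↭ refl          inv = refl
  assignmentSum-↭ (prep p ps↭)  inv =
    ∑ℕ-cong L (λ _ → assignmentSum-↭ ps↭ (λ σ↭τ → inv (prep _ σ↭τ)))
  assignmentSum-↭ (transitive ↭₁ ↭₂) inv = trans (assignmentSum-↭ ↭₁ inv) (assignmentSum-↭ ↭₂ inv)
  assignmentSum-↭ (swap {_} {qs} p q ps↭) inv = trans
    (∑ℕ-cong L (λ _ → ∑ℕ-cong L (λ _ → trans
      (assignmentSum-↭ ps↭ (λ σ↭τ → inv (prep _ (prep _ σ↭τ))))
      (assignmentSum-cong qs (λ _ _ → inv (swap _ _ ↭-refl))))))
    (∑ℕ-comm _ L L)

assignmentSum-letters-↭ : ∀ {X A : Set} {L L′ : List A} → L ↭ L′ → ∀ (ps : List X) h →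
                          assignmentSum L ps h ≡ assignmentSum L′ ps h
assignmentSum-letters-↭ L↭L′ []       h = refl
assignmentSum-letters-↭ {L = L} L↭L′ (p ∷ ps) h =
  trans (∑ℕ-cong L (λ _ → assignmentSum-letters-↭ L↭L′ ps _)) (∑ℕ-↭ _ L↭L′)

-- The case of two letters

letters₂ : List Bool
letters₂ = false ∷ true ∷ []

#false #true : {X : Set} → Assignment X Bool → ℕ
#false σ = ∑ℕ σ (λ px → if proj₂ px then 0 else 1)
#true  σ = ∑ℕ σ (λ px → if proj₂ px then 1 else 0)

split₂ : ∀ {X : Set} {u v : X} {ps} → u ∈ ps → v ∈ ps → u ≢ v → ∃[ qs ] ps ↭ u ∷ v ∷ qs
split₂ {u = u} {v} u∈ v∈ u≢v with ∈-∃++ u∈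
... | as , bs , refl with ∈-resp-↭ (shift u as bs) v∈
...   | here v≡u = ⊥-elim (u≢v (sym v≡u))
...   | there v∈′ with as ++ bs in eq | ∈-∃++ v∈′
...     | _ | cs , ds , refl = cs ++ ds ,
  ↭-trans (shift u as bs) (prep u (subst (_↭ v ∷ cs ++ ds) (sym eq) (shift v cs ds)))

module TwoLetters {M : Set} {_∙_ : M → M → M} {ε : M} (isCM : IsCommutativeMonoid _≡_ _∙_ ε)
                  {X : Set} where

  open IsCommutativeMonoid isCM using (assoc; identityˡ; identityʳ)
  open Sums isCM

  Weight : Set
  Weight = X → X → M

  pairWeight₂ : Weight → X × Bool → X × Bool → M
  pairWeight₂ w (u , false) (v , true) = w u v
  pairWeight₂ w _           _          = ε

  stat₂ : Weight → Assignment X Bool → M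
  stat₂ w = pairSum (pairWeight₂ w)

  -- As `f` is arbitrary, this concerns the joint distribution of the statistic and the two letter
  -- counts. It also lets constant shifts of all three be absorbed into `f` during the inductions.
  Symmetric₂ : Weight → List X → Set
  Symmetric₂ w ps = ∀ (f : M → ℕ → ℕ → ℕ) →
    assignmentSum letters₂ ps (λ σ → f (stat₂ w σ) (#false σ) (#true σ)) ≡
    assignmentSum letters₂ ps (λ σ → f (stat₂ w σ) (#true σ) (#false σ))

  Symmetric₂-↭ : ∀ {w ps qs} → ps ↭ qs → Symmetric₂ w ps → Symmetric₂ w qs
  Symmetric₂-↭ {w} ps↭qs S f =
    trans (sym (assignmentSum-↭ letters₂ ps↭qs inv)) (trans (S f) (assignmentSum-↭ letters₂ ps↭qs inv′))
    where
    inv : Invariant (λ σ → f (stat₂ w σ) (#false σ) (#true σ))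
    inv σ↭τ rewrite pairSum-↭ (pairWeight₂ w) σ↭τ
                  | ∑ℕ-↭ (λ px → if proj₂ px then 0 else 1) σ↭τ
                  | ∑ℕ-↭ (λ px → if proj₂ px then 1 else 0) σ↭τ = refl
    inv′ : Invariant (λ σ → f (stat₂ w σ) (#true σ) (#false σ))
    inv′ σ↭τ rewrite pairSum-↭ (pairWeight₂ w) σ↭τ
                   | ∑ℕ-↭ (λ px → if proj₂ px then 0 else 1) σ↭τ
                   | ∑ℕ-↭ (λ px → if proj₂ px then 1 else 0) σ↭τ = refl

  pairWeight₂-cong : ∀ {w w′} p q → w (proj₁ p) (proj₁ q) ≡ w′ (proj₁ p) (proj₁ q) →
                     pairWeight₂ w p q ≡ pairWeight₂ w′ p q
  pairWeight₂-cong (_ , false) (_ , true)  eq = eq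
  pairWeight₂-cong (_ , false) (_ , false) eq = refl
  pairWeight₂-cong (_ , true)  _           eq = refl

  cell∈ : ∀ {σ : Assignment X Bool} {ps p} → map proj₁ σ ≡ ps → p ∈ σ → proj₁ p ∈ ps
  cell∈ refl (here refl) = here refl
  cell∈ refl (there p∈)  = there (cell∈ refl p∈)

  stat₂-cong : ∀ {w w′ ps} → (∀ {p q} → p ∈ ps → q ∈ ps → w p q ≡ w′ p q) →
               ∀ σ → map proj₁ σ ≡ ps → stat₂ w σ ≡ stat₂ w′ σ
  stat₂-cong w≡w′ σ eq =
    pairSum-cong σ (λ {p} {q} p∈ q∈ → pairWeight₂-cong p q (w≡w′ (cell∈ eq p∈) (cell∈ eq q∈)))

  Symmetric₂-cong : ∀ {w w′ ps} → (∀ {p q} → p ∈ ps → q ∈ ps → w p q ≡ w′ p q) →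
                    Symmetric₂ w ps → Symmetric₂ w′ ps
  Symmetric₂-cong {w} {w′} {ps} w≡w′ S f = trans
    (assignmentSum-cong letters₂ ps (λ σ eq → cong (λ m → f m (#false σ) (#true σ)) (sym (stat₂-cong w≡w′ σ eq))))
    (trans (S f)
      (assignmentSum-cong letters₂ ps (λ σ eq → cong (λ m → f m (#true σ) (#false σ)) (stat₂-cong w≡w′ σ eq))))

  -- Only the counts matter here, and changing the letter of every cell exchanges them.
  Symmetric₂-ε : ∀ ps → Symmetric₂ (λ _ _ → ε) ps
  Symmetric₂-ε ps f = trans
    (assignmentSum-cong letters₂ ps (λ σ _ → cong (λ m → f m (#false σ) (#true σ)) (stat≡ε σ)))
    (trans (flip ps (f ε))
      (assignmentSum-cong letters₂ ps (λ σ _ → cong (λ m → f m (#true σ) (#false σ)) (sym (stat≡ε σ)))))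
    where
    weight≡ε : ∀ p q → pairWeight₂ (λ _ _ → ε) p q ≡ ε
    weight≡ε (_ , false) (_ , true)  = refl
    weight≡ε (_ , false) (_ , false) = refl
    weight≡ε (_ , true)  _           = refl
    stat≡ε : ∀ σ → stat₂ (λ _ _ → ε) σ ≡ ε
    stat≡ε []      = refl
    stat≡ε (p ∷ σ) = trans
      (cong₂ _∙_ (∑-ε σ (λ {q} _ → trans (cong₂ _∙_ (weight≡ε p q) (weight≡ε q p)) (identityˡ ε))) (stat≡ε σ))
      (identityˡ ε)
    flip : ∀ ps (f : ℕ → ℕ → ℕ) → assignmentSum letters₂ ps (λ σ → f (#false σ) (#true σ)) ≡
                                  assignmentSum letters₂ ps (λ σ → f (#true σ) (#false σ))
    flip []       f = refl
    flip (p ∷ ps) f = trans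
      (cong₂ (λ a b → a + (b + 0)) (flip ps (λ a b → f (suc a) b)) (flip ps (λ a b → f a (suc b))))
      (solve 2 (λ a b → a :+ (b :+ con 0) := b :+ (a :+ con 0)) refl
        (assignmentSum letters₂ ps (λ σ → f (suc (#true σ)) (#false σ)))
        (assignmentSum letters₂ ps (λ σ → f (#true σ) (suc (#false σ)))))
      where open +-*-Solver

  -- If u is sent to false and v to true, every other cell q contributes
  -- w u q or w q v according to its letter, so with w u q ≡ w q v these
  -- assignments form a shifted copy of those of the remaining cells.  The
  -- other assignments do not see w u v and are counted by subtraction.
  exchange : ∀ {w w′ : Weight} {u v ps} →
             (∀ {q} → q ∈ ps → w u q ≡ w q v) →
             w v u ≡ w′ v u →
             (∀ {q} → q ∈ ps → w u q ≡ w′ u q × w q u ≡ w′ q u × w v q ≡ w′ v q × w q v ≡ w′ q v) →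
             (∀ {p q} → p ∈ ps → q ∈ ps → w p q ≡ w′ p q) →
             Symmetric₂ w ps → Symmetric₂ w′ (u ∷ v ∷ ps) → Symmetric₂ w (u ∷ v ∷ ps)
  exchange {w} {w′} {u} {v} {ps} balanced vu≡ cross≡ inner≡ S S′ f = begin
    total w F                    ≡⟨ split w F ⟩
    corner w F + rest w F        ≡⟨ cong₂ _+_ (corner-sym w balanced S f) rest-sym ⟩
    corner w F° + rest w F°      ≡⟨ split w F° ⟨
    total w F°                   ∎
    where
    open ≡-Reasoning
    Test : Set
    Test = M → ℕ → ℕ → ℕ
    F F° : Test
    F      = f
    F° m a b = f m b a

    evaluate : Weight → Test → Assignment X Bool → ℕ
    evaluate w f σ = f (stat₂ w σ) (#false σ) (#true σ)

    part : Bool → Bool → Weight → Test → ℕ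
    part x y w f = assignmentSum letters₂ ps (λ σ → evaluate w f ((u , x) ∷ (v , y) ∷ σ))

    total corner rest : Weight → Test → ℕ
    total  w f = assignmentSum letters₂ (u ∷ v ∷ ps) (evaluate w f)
    corner w f = part false true w f
    rest   w f = part false false w f + (part true false w f + part true true w f)

    split : ∀ w f → total w f ≡ corner w f + rest w f
    split w f = solve 4 (λ a b c d → (a :+ (b :+ con 0)) :+ ((c :+ (d :+ con 0)) :+ con 0) := b :+ (a :+ (c :+ d))) refl
      (part false false w f) (part false true w f) (part true false w f) (part true true w f)
      where open +-*-Solver

    stat-corner : ∀ w → (∀ {q} → q ∈ ps → w u q ≡ w q v) → ∀ σ → map proj₁ σ ≡ ps →
                  stat₂ w ((u , false) ∷ (v , true) ∷ σ) ≡ (w u v ∙ ∑ ps (w u)) ∙ stat₂ w σ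
    stat-corner w balanced σ eq = begin
      (((w u v ∙ ε) ∙ ∑ σ from-u) ∙ (∑ σ to-v ∙ stat₂ w σ)) ≡⟨ assoc _ _ _ ⟨
      ((((w u v ∙ ε) ∙ ∑ σ from-u) ∙ ∑ σ to-v) ∙ stat₂ w σ) ≡⟨ cong (_∙ stat₂ w σ) (assoc _ _ _) ⟩
      (((w u v ∙ ε) ∙ (∑ σ from-u ∙ ∑ σ to-v)) ∙ stat₂ w σ) ≡⟨ cong (_∙ stat₂ w σ) (cong₂ _∙_ (identityʳ _) others) ⟩
      ((w u v ∙ ∑ ps (w u)) ∙ stat₂ w σ)                    ∎
      where
      from-u to-v : X × Bool → M
      from-u q = pairWeight₂ w (u , false) q ∙ pairWeight₂ w q (u , false)
      to-v   q = pairWeight₂ w (v , true) q ∙ pairWeight₂ w q (v , true)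
      one : ∀ {q} → q ∈ σ → from-u q ∙ to-v q ≡ w u (proj₁ q)
      one {_ , false} q∈ = trans (cong₂ _∙_ (identityˡ ε) (identityˡ _)) (trans (identityˡ _) (sym (balanced (cell∈ eq q∈))))
      one {_ , true}  q∈ = trans (cong₂ _∙_ (identityʳ _) (identityˡ ε)) (identityʳ _)
      others : ∑ σ from-u ∙ ∑ σ to-v ≡ ∑ ps (w u)
      others = trans (sym (∑-∙ from-u to-v σ)) (trans (∑-cong σ one)
        (trans (sym (∑-map proj₁ (w u) σ)) (cong (λ ps → ∑ ps (w u)) eq)))

    corner-sym : ∀ w → (∀ {q} → q ∈ ps → w u q ≡ w q v) → Symmetric₂ w ps →
                 ∀ f → corner w f ≡ corner w (λ m a b → f m b a)
    corner-sym w balanced S f = trans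
      (assignmentSum-cong letters₂ ps (λ σ eq → cong (λ m → f m (suc (#false σ)) (suc (#true σ))) (stat-corner w balanced σ eq)))
      -- The constant contribution of `u` and `v`, and the one letter of each kind that they add,
      -- are built into the test function.
      (trans (S (λ m a b → f ((w u v ∙ ∑ ps (w u)) ∙ m) (suc a) (suc b)))
        (assignmentSum-cong letters₂ ps (λ σ eq → cong (λ m → f m (suc (#true σ)) (suc (#false σ))) (sym (stat-corner w balanced σ eq)))))

    balanced′ : ∀ {q} → q ∈ ps → w′ u q ≡ w′ q v
    balanced′ q∈ = let uq , _ , _ , qv = cross≡ q∈ in trans (sym uq) (trans (balanced q∈) qv)

    part≡ : ∀ x y f → pairWeight₂ w (u , x) (v , y) ≡ pairWeight₂ w′ (u , x) (v , y) → part x y w f ≡ part x y w′ f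
    part≡ x y f uv≡ = assignmentSum-cong letters₂ ps (λ σ eq →
      cong (λ m → f m (#false ((u , x) ∷ (v , y) ∷ σ)) (#true ((u , x) ∷ (v , y) ∷ σ))) (cong₂ _∙_
        (cong₂ _∙_
          (cong₂ _∙_ uv≡ (pairWeight₂-cong (v , y) (u , x) vu≡))
          (∑-cong σ (λ {q} q∈ → let uq , qu , _ = cross≡ (cell∈ eq q∈) in
            cong₂ _∙_ (pairWeight₂-cong (u , x) q uq) (pairWeight₂-cong q (u , x) qu))))
        (cong₂ _∙_
          (∑-cong σ (λ {q} q∈ → let _ , _ , vq , qv = cross≡ (cell∈ eq q∈) in
            cong₂ _∙_ (pairWeight₂-cong (v , y) q vq) (pairWeight₂-cong q (v , y) qv)))
          (stat₂-cong inner≡ σ eq))))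

    rest≡ : ∀ f → rest w f ≡ rest w′ f
    -- Unless `u` has false and `v` has true, the pair (`u`, `v`) weighs `ε` for `w` and `w′` alike,
    -- hence `refl`.
    rest≡ f = cong₂ _+_ (part≡ false false f refl) (cong₂ _+_ (part≡ true false f refl) (part≡ true true f refl))

    rest-sym : rest w F ≡ rest w F°
    -- For `w′` both the total and the corner are symmetric, so cancelling the corner leaves a
    -- symmetric rest, and `w` has the same rest.
    rest-sym = trans (rest≡ F) (trans
      (+-cancelˡ-≡ (corner w′ F) _ _ (trans (sym (split w′ F)) (trans (S′ F) (trans (split w′ F°)
        (cong (_+ rest w′ F°) (sym (corner-sym w′ balanced′ (Symmetric₂-cong inner≡ S) F)))))))
      (sym (rest≡ F°)))

  Distinct : (X → ℕ) → List X → Set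
  Distinct pos = AllPairs (λ p q → pos p ≢ pos q)

  -- Weights determined by the distance of positions

  module _ (pos : X → ℕ) (t : M) where

    -- The bound b serves to switch on the weights at distance k one by one.
    opaque
      attack : ℕ → (X → M) → ℕ → Weight
      attack k c b u v =
        if does (pos u <? pos v)
        then (if does (pos v <? pos u + k)
              then t
              else (if does (pos v ≟ pos u + k) ∧ does (pos u <? b) then c u else ε))
        else ε

      attack-near : ∀ {k c b u v} → pos u < pos v → pos v < pos u + k → attack k c b u v ≡ t
      attack-near {k} {c} {b} {u} {v} u<v v<u+k
        rewrite dec-true (pos u <? pos v) u<v | dec-true (pos v <? pos u + k) v<u+k = refl

      attack-at : ∀ {k c b u v} → pos u < pos v → pos v ≡ pos u + k → pos u < b → attack k c b u v ≡ c u
      attack-at {k} {c} {b} {u} {v} u<v v≡u+k u<b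
        rewrite dec-true (pos u <? pos v) u<v | dec-false (pos v <? pos u + k) (<-irrefl v≡u+k)
              | dec-true (pos v ≟ pos u + k) v≡u+k | dec-true (pos u <? b) u<b = refl

      attack-at-≥ : ∀ {k c b u v} → pos v ≡ pos u + k → ¬ pos u < b → attack k c b u v ≡ ε
      attack-at-≥ {k} {c} {b} {u} {v} v≡u+k u≮b with does (pos u <? pos v)
      ... | false = refl
      ... | true
        rewrite dec-false (pos v <? pos u + k) (<-irrefl v≡u+k)
              | dec-true (pos v ≟ pos u + k) v≡u+k | dec-false (pos u <? b) u≮b = refl

      attack-far : ∀ {k c b u v} → pos u + k < pos v → attack k c b u v ≡ ε
      attack-far {k} {c} {b} {u} {v} u+k<v with does (pos u <? pos v)
      ... | false = refl
      ... | true
        rewrite dec-false (pos v <? pos u + k) (<-asym u+k<v)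
              | dec-false (pos v ≟ pos u + k) (λ v≡ → <-irrefl (sym v≡) u+k<v) = refl

      attack-back : ∀ {k c b u v} → ¬ pos u < pos v → attack k c b u v ≡ ε
      attack-back {k} {c} {b} {u} {v} u≮v rewrite dec-false (pos u <? pos v) u≮v = refl

    attack-0 : ∀ c b u v → attack 0 c b u v ≡ ε
    attack-0 c b u v = case pos u <? pos v of λ where
      (yes u<v) → attack-far (subst (_< pos v) (sym (+-identityʳ (pos u))) u<v)
      (no  u≮v) → attack-back u≮v

    -- With bound 0 no weight at distance `suc k` is switched on, so the weights are `t` up to
    -- distance `k`. Read at `k`, the outermost weights are constantly `t` and all switched on up to
    -- `B`. This is the descent in `k`.
    attack-suc-0 : ∀ k c B u v → pos u < B → attack (suc k) c 0 u v ≡ attack k (λ _ → t) B u v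
    attack-suc-0 k c B u v u<B = case pos u <? pos v of λ where
        (no  u≮v) → trans (attack-back u≮v) (sym (attack-back u≮v))
        (yes u<v) → case <-cmp (pos v) (pos u + k) of λ where
          (tri< v<u+k _ _) → trans (attack-near u<v (<-≤-trans v<u+k (+-monoʳ-≤ (pos u) (n≤1+n k))))
                                   (sym (attack-near u<v v<u+k))
          (tri≈ _ v≡u+k _) → trans (attack-near u<v (≤-reflexive (trans (cong suc v≡u+k) (sym (+-suc (pos u) k)))))
                                   (sym (attack-at u<v v≡u+k u<B))
          (tri> _ _ u+k<v) → trans (beyond (m≤n⇒m<n∨m≡n (subst (_≤ pos v) (sym (+-suc (pos u) k)) u+k<v)))
                                   (sym (attack-far u+k<v))
      where
      beyond : pos u + suc k < pos v ⊎ pos u + suc k ≡ pos v → attack (suc k) c 0 u v ≡ ε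
      beyond (inj₁ u+k<v) = attack-far u+k<v
      beyond (inj₂ u+k≡v) = attack-at-≥ (sym u+k≡v) (λ ())

    attack-step : ∀ k c b u v → ¬ (pos u ≡ b × pos v ≡ b + k) → attack k c (suc b) u v ≡ attack k c b u v
    attack-step k c b u v ≢b = case pos u <? pos v of λ where
      (no  u≮v) → trans (attack-back u≮v) (sym (attack-back u≮v))
      (yes u<v) → case <-cmp (pos v) (pos u + k) of λ where
        (tri< v<u+k _ _) → trans (attack-near u<v v<u+k) (sym (attack-near u<v v<u+k))
        (tri> _ _ u+k<v) → trans (attack-far u+k<v) (sym (attack-far u+k<v))
        (tri≈ _ v≡u+k _) → case <-cmp (pos u) b of λ where
          (tri< u<b _ _) → trans (attack-at u<v v≡u+k (m<n⇒m<1+n u<b)) (sym (attack-at u<v v≡u+k u<b))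
          (tri≈ _ u≡b _) → ⊥-elim (≢b (u≡b , trans v≡u+k (cong (_+ k) u≡b)))
          (tri> u≮b _ b<u) → trans (attack-at-≥ v≡u+k (≤⇒≯ b<u)) (sym (attack-at-≥ v≡u+k u≮b))

    -- If `q` lies strictly between `u` and `v`, it is at distance less than `k` from both, and both
    -- weights are `t`. If it lies before `u` or after `v`, one of the two pairs runs backwards and
    -- the other is longer than `k`, so both weights are `ε`. This is the balance that `exchange`
    -- asks for.
    attack-balanced : ∀ k c b {u v} q → pos v ≡ pos u + k → pos q ≢ pos u → pos q ≢ pos v →
                      attack k c b u q ≡ attack k c b q v
    attack-balanced k c b {u} {v} q v≡u+k q≢u q≢v = case <-cmp (pos q) (pos u) of λ where
      (tri< q<u _ u≮q) → trans (attack-back u≮q)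
        (sym (attack-far (subst (pos q + k <_) (sym v≡u+k) (+-monoˡ-< k q<u))))
      (tri≈ _ q≡u _) → ⊥-elim (q≢u q≡u)
      (tri> _ _ u<q) → case <-cmp (pos q) (pos v) of λ where
        (tri< q<v _ _) → trans (attack-near u<q (subst (pos q <_) v≡u+k q<v))
          (sym (attack-near q<v (subst (_< pos q + k) (sym v≡u+k) (+-monoˡ-< k u<q))))
        (tri≈ _ q≡v _) → ⊥-elim (q≢v q≡v)
        (tri> q≮v _ v<q) → trans (attack-far (subst (_< pos q) v≡u+k v<q)) (sym (attack-back q≮v))

    bounded : ∀ ps → ∃[ B ] (∀ {p} → p ∈ ps → pos p < B)
    bounded []       = 0 , λ ()
    bounded (p ∷ ps) = let B , <B = bounded ps in suc (pos p) ⊔ B , λ where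
      (here refl) → m≤m⊔n (suc (pos p)) B
      (there q∈)  → ≤-trans (<B q∈) (m≤n⊔m (suc (pos p)) B)

    -- `exchange` is applied to the bounds `suc b` and `b`. Since positions are distinct,
    -- `attack-step` shows that the two weights differ at the pair (`u`, `v`) only.
    removeCorner : ∀ {k c b u v ps qs} → ps ↭ u ∷ v ∷ qs → Distinct pos ps →
                   pos u ≡ b → pos v ≡ b + k →
                   Symmetric₂ (attack k c (suc b)) qs → Symmetric₂ (attack k c b) ps →
                   Symmetric₂ (attack k c (suc b)) ps
    removeCorner {k} {c} {b} {u} {v} {ps} {qs} ps↭ ps! u≡ v≡ S S′
      with AllPairs-resp-↭ (setoid X) (_∘ sym) (resp₂ _) (↭⇒↭ₛ ps↭) ps!
    ... | (u≢v ∷ u≢qs) ∷ v≢qs ∷ qs! = Symmetric₂-↭ (↭-sym ps↭) (exchange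
      (λ {q} q∈ → attack-balanced k c (suc b) q (trans v≡ (cong (_+ k) (sym u≡))) (≢u q∈) (≢v q∈))
      (attack-step k c b v u (λ (v≡b , _) → u≢v (trans u≡ (sym v≡b))))
      (λ {q} q∈ → attack-step k c b u q (λ (_ , q≡) → ≢v q∈ (trans q≡ (sym v≡)))
                , attack-step k c b q u (λ (q≡b , _) → ≢u q∈ (trans q≡b (sym u≡)))
                , attack-step k c b v q (λ (v≡b , _) → u≢v (trans u≡ (sym v≡b)))
                , attack-step k c b q v (λ (q≡b , _) → ≢u q∈ (trans q≡b (sym u≡))))
      (λ {p} {q} p∈ _ → attack-step k c b p q (λ (p≡b , _) → ≢u p∈ (trans p≡b (sym u≡))))
      S (Symmetric₂-↭ ps↭ S′))
      where
      ≢u : ∀ {q} → q ∈ qs → pos q ≢ pos u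
      ≢u q∈ = All.lookup u≢qs q∈ ∘ sym
      ≢v : ∀ {q} → q ∈ qs → pos q ≢ pos v
      ≢v q∈ = All.lookup v≢qs q∈ ∘ sym

    activateCorner : ∀ {k c b ps} → Distinct pos ps →
                     (∀ {qs} → length qs < length ps → Distinct pos qs → Symmetric₂ (attack (suc k) c (suc b)) qs) →
                     Symmetric₂ (attack (suc k) c b) ps → Symmetric₂ (attack (suc k) c (suc b)) ps
    activateCorner {k} {c} {b} {ps} ps! smaller S
      with any? (λ p → pos p ≟ b) ps | any? (λ p → pos p ≟ b + suc k) ps
    -- If position `b` or `b + suc k` is vacant, raising the bound changes no weight.
    ... | no b∉ | _ = Symmetric₂-cong
      (λ {u} {v} u∈ _ → sym (attack-step (suc k) c b u v (λ (u≡b , _) → b∉ (lose u∈ u≡b)))) S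
    ... | yes _ | no b+k∉ = Symmetric₂-cong
      (λ {u} {v} _ v∈ → sym (attack-step (suc k) c b u v (λ (_ , v≡) → b+k∉ (lose v∈ v≡)))) S
    ... | yes b∈ | yes b+k∈ with find b∈ | find b+k∈
    ...   | u , u∈ , u≡ | v , v∈ , v≡
      with split₂ u∈ v∈ (λ u≡v → m≢1+m+n b (trans (sym u≡) (trans (cong pos u≡v) (trans v≡ (+-suc b k)))))
    ...     | qs , ps↭ with AllPairs-resp-↭ (setoid X) (_∘ sym) (resp₂ _) (↭⇒↭ₛ ps↭) ps!
    ...       | _ ∷ _ ∷ qs! = removeCorner ps↭ ps! u≡ v≡
      (smaller (subst (length qs <_) (sym (↭-length ps↭)) (n≤1+n _)) qs!) S

    -- Lexicographic induction on the bound `n` for the number of cells, then on `k`, then on `b`.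
    -- Removing a corner lowers `n`, switching off a weight lowers `b`, and at `b = 0` the distance
    -- drops while the bound is reset to exceed all positions. At `k = 0` every weight is `ε`.
    attack-symmetric′ : ∀ n k c b ps → length ps ≤ n → Distinct pos ps → Symmetric₂ (attack k c b) ps
    attack-symmetric′ zero    k       c b       []  _    _   = λ _ → refl
    attack-symmetric′ (suc n) zero    c b       ps ps≤n ps! =
      Symmetric₂-cong {ps = ps} (λ {u} {v} _ _ → sym (attack-0 c b u v)) (Symmetric₂-ε ps)
    attack-symmetric′ (suc n) (suc k) c zero    ps ps≤n ps! = let B , <B = bounded ps in
      Symmetric₂-cong (λ {u} {v} u∈ _ → sym (attack-suc-0 k c B u v (<B u∈)))
        (attack-symmetric′ (suc n) k (λ _ → t) B ps ps≤n ps!)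
    attack-symmetric′ (suc n) (suc k) c (suc b) ps ps≤n ps! = activateCorner ps!
      (λ {qs} qs<ps qs! → attack-symmetric′ n (suc k) c (suc b) qs (s≤s⁻¹ (<-≤-trans qs<ps ps≤n)) qs!)
      (attack-symmetric′ (suc n) (suc k) c b ps ps≤n ps!)

    attack-symmetric : ∀ k c b ps → Distinct pos ps → Symmetric₂ (attack k c b) ps
    attack-symmetric k c b ps = attack-symmetric′ (length ps) k c b ps ≤-refl

-- Reduction to two letters

transpose : ℤ⁺ → ℤ⁺ → ℤ⁺ → ℤ⁺
transpose α β x with x ≟⁺ α | x ≟⁺ β
... | yes _ | _     = β
... | no  _ | yes _ = α
... | no  _ | no  _ = x

transpose-left : ∀ α β → transpose α β α ≡ β
transpose-left α β with α ≟⁺ α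
... | yes _  = refl
... | no α≢α = ⊥-elim (α≢α refl)

transpose-right : ∀ α β → transpose α β β ≡ α
transpose-right α β with β ≟⁺ α | β ≟⁺ β
... | yes β≡α | _      = β≡α
... | no _    | yes _  = refl
... | no _    | no β≢β = ⊥-elim (β≢β refl)

transpose-other : ∀ {α β x} → x ≢ α → x ≢ β → transpose α β x ≡ x
transpose-other {α} {β} {x} x≢α x≢β with x ≟⁺ α | x ≟⁺ β
... | yes x≡α | _       = ⊥-elim (x≢α x≡α)
... | no _    | yes x≡β = ⊥-elim (x≢β x≡β)
... | no _    | no _    = refl

-- Indexed by a letter together with its image, so that one match determines both.
data TransposeView (α β : ℤ⁺) : ℤ⁺ → ℤ⁺ → Set where
  left  : TransposeView α β α β
  right : TransposeView α β β α
  other : ∀ {x} → x ≢ α → x ≢ β → TransposeView α β x x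

transposeView : ∀ α β x → TransposeView α β x (transpose α β x)
transposeView α β x with x ≟⁺ α | x ≟⁺ β
... | yes refl | _        = left
... | no _     | yes refl = right
... | no x≢α   | no x≢β   = other x≢α x≢β

transpose-involutive : ∀ α β x → transpose α β (transpose α β x) ≡ x
transpose-involutive α β x with transpose α β x | transposeView α β x
... | _ | left          = transpose-right α β
... | _ | right         = transpose-left α β
... | _ | other x≢α x≢β = transpose-other x≢α x≢β

transpose-sym : ∀ α β x → transpose α β x ≡ transpose β α x
transpose-sym α β x with transpose α β x | transposeView α β x
... | _ | left          = sym (transpose-right β α)
... | _ | right         = sym (transpose-left β α)
... | _ | other x≢α x≢β = sym (transpose-other x≢β x≢α)

transpose-trivial : ∀ α x → transpose α α x ≡ x
transpose-trivial α x with transpose α α x | transposeView α α x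
... | _ | left      = refl
... | _ | right     = refl
... | _ | other _ _ = refl

transpose-conjugate : ∀ {α β γ} → α ≢ β → α ≢ γ → β ≢ γ → ∀ x →
                      transpose β γ (transpose α β (transpose β γ x)) ≡ transpose α γ x
transpose-conjugate {α} {β} {γ} α≢β α≢γ β≢γ x with transpose α γ x | transposeView α γ x
... | _ | left = trans (cong (transpose β γ ∘ transpose α β) (transpose-other α≢β α≢γ))
                   (trans (cong (transpose β γ) (transpose-left α β)) (transpose-left β γ))
... | _ | right = trans (cong (transpose β γ ∘ transpose α β) (transpose-right β γ))
                    (trans (cong (transpose β γ) (transpose-right α β)) (transpose-other α≢β α≢γ))
... | _ | other x≢α x≢γ = case x ≟⁺ β of λ where
  (yes refl) → trans (cong (transpose β γ ∘ transpose α β) (transpose-left β γ))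
    (trans (cong (transpose β γ) (transpose-other (α≢γ ∘ sym) (β≢γ ∘ sym))) (transpose-right β γ))
  (no x≢β) → trans (cong (transpose β γ ∘ transpose α β) (transpose-other x≢β x≢γ))
    (trans (cong (transpose β γ) (transpose-other x≢α x≢β)) (transpose-other x≢β x≢γ))

-- Separating two consecutive letters from the others

module Letters {M : Set} {_∙_ : M → M → M} {ε : M} (isCM : IsCommutativeMonoid _≡_ _∙_ ε)
               {X : Set} where

  open IsCommutativeMonoid isCM using (identityˡ; identityʳ)
  open Sums isCM
  open TwoLetters isCM {X}

  pairWeight : Weight → X × ℤ⁺ → X × ℤ⁺ → M
  pairWeight w (u , x) (v , y) = if does (value x <? value y) then w u v else ε

  stat : Weight → Assignment X ℤ⁺ → M
  stat w = pairSum (pairWeight w)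

  module _ (a : ℕ) where

    private
      α β : ℤ⁺
      α = 1+ a
      β = 1+ suc a

    decode : X × Bool → X × ℤ⁺
    decode (p , x) = p , (if x then β else α)

    Outside : X × ℤ⁺ → Set
    Outside (_ , x) = x ≢ α × x ≢ β

    -- Here φ places the letters other than α and β, and fs are the cells left over.
    reduce-to-two : ∀ {L} → All (λ x → x ≢ α × x ≢ β) L → ∀ ps {h h′} → Invariant h → Invariant h′ →
                    (∀ φ fs → All Outside φ → fs ⊆ ps →
                      assignmentSum letters₂ fs (λ τ → h (φ ++ map decode τ)) ≡
                      assignmentSum letters₂ fs (λ τ → h′ (φ ++ map decode τ))) →
                    assignmentSum (α ∷ β ∷ L) ps h ≡ assignmentSum (α ∷ β ∷ L) ps h′
    reduce-to-two out []       inv inv′ two = two [] [] [] []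
    reduce-to-two {L} out (p ∷ ps) {h} {h′} inv inv′ two = begin
      S h α + (S h β + ∑ℕ L (S h))   ≡⟨ +-assoc (S h α) _ _ ⟨
      (S h α + S h β) + ∑ℕ L (S h)   ≡⟨ cong₂ _+_ free fixed ⟩
      (S h′ α + S h′ β) + ∑ℕ L (S h′) ≡⟨ +-assoc (S h′ α) _ _ ⟩
      S h′ α + (S h′ β + ∑ℕ L (S h′)) ∎
      where
      open ≡-Reasoning
      S : (Assignment X ℤ⁺ → ℕ) → ℤ⁺ → ℕ
      S h x = assignmentSum (α ∷ β ∷ L) ps (λ σ → h ((p , x) ∷ σ))
      fixed : ∑ℕ L (S h) ≡ ∑ℕ L (S h′)
      fixed = ∑ℕ-cong L (λ {x} x∈ → reduce-to-two out ps (inv ∘ prep _) (inv′ ∘ prep _)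
        (λ φ fs φ-out fs⊆ → two ((p , x) ∷ φ) fs (All.lookup out x∈ ∷ φ-out) (p ∷ʳ fs⊆)))
      -- The two choices at `p` are put into one test function on the remaining cells, so that the
      -- induction applies to `ps`; in the two-letter hypothesis `p` then joins the leftover cells,
      -- being moved past `φ` by invariance.
      both : (Assignment X ℤ⁺ → ℕ) → Assignment X ℤ⁺ → ℕ
      both h σ = h ((p , α) ∷ σ) + h ((p , β) ∷ σ)
      gather : ∀ {h} → Invariant h → ∀ φ fs →
               assignmentSum letters₂ fs (λ τ → both h (φ ++ map decode τ)) ≡
               assignmentSum letters₂ (p ∷ fs) (λ τ → h (φ ++ map decode τ))
      gather {h} inv φ fs = trans (assignmentSum-+ letters₂ fs _ _) (cong₂ _+_
        (assignmentSum-cong letters₂ fs (λ τ _ → inv (↭-sym (shift (p , α) φ (map decode τ)))))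
        (trans (assignmentSum-cong letters₂ fs (λ τ _ → inv (↭-sym (shift (p , β) φ (map decode τ)))))
          (sym (+-identityʳ _))))
      free : S h α + S h β ≡ S h′ α + S h′ β
      free = begin
        S h α + S h β                            ≡⟨ assignmentSum-+ (α ∷ β ∷ L) ps _ _ ⟨
        assignmentSum (α ∷ β ∷ L) ps (both h)    ≡⟨ reduce-to-two out ps
          (λ σ↭τ → cong₂ _+_ (inv (prep _ σ↭τ)) (inv (prep _ σ↭τ)))
          (λ σ↭τ → cong₂ _+_ (inv′ (prep _ σ↭τ)) (inv′ (prep _ σ↭τ)))
          (λ φ fs φ-out fs⊆ → trans (gather inv φ fs)
            (trans (two φ (p ∷ fs) φ-out (refl ∷ fs⊆)) (sym (gather inv′ φ fs)))) ⟩
        assignmentSum (α ∷ β ∷ L) ps (both h′)   ≡⟨ assignmentSum-+ (α ∷ β ∷ L) ps _ _ ⟩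
        S h′ α + S h′ β                          ∎

    collapse : ℤ⁺ → ℤ⁺
    collapse x = if does (x ≟⁺ β) then α else x

    collapseCell : X × ℤ⁺ → X × ℤ⁺
    collapseCell (p , x) = p , collapse x

    collapse-β : collapse β ≡ α
    collapse-β rewrite dec-true (β ≟⁺ β) refl = refl

    collapse-other : ∀ {x} → x ≢ β → collapse x ≡ x
    collapse-other {x} x≢β rewrite dec-false (x ≟⁺ β) x≢β = refl

    module _ (w : Weight) {u v : X} {x y : ℤ⁺} where

      pairWeight-< : value x < value y → pairWeight w (u , x) (v , y) ≡ w u v
      pairWeight-< x<y rewrite dec-true (value x <? value y) x<y = refl

      pairWeight-≮ : ¬ value x < value y → pairWeight w (u , x) (v , y) ≡ ε
      pairWeight-≮ x≮y rewrite dec-false (value x <? value y) x≮y = refl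

    opaque
      pairWeight-αβ : Weight → X × ℤ⁺ → X × ℤ⁺ → M
      pairWeight-αβ w (u , x) (v , y) = if does (x ≟⁺ α) ∧ does (y ≟⁺ β) then w u v else ε

      pairWeight-αβ-yes : ∀ w {u v x y} → x ≡ α → y ≡ β → pairWeight-αβ w (u , x) (v , y) ≡ w u v
      pairWeight-αβ-yes w {x = x} {y} x≡α y≡β rewrite dec-true (x ≟⁺ α) x≡α | dec-true (y ≟⁺ β) y≡β = refl

      pairWeight-αβ-≢α : ∀ w {u v x y} → x ≢ α → pairWeight-αβ w (u , x) (v , y) ≡ ε
      pairWeight-αβ-≢α w {x = x} x≢α rewrite dec-false (x ≟⁺ α) x≢α = refl

      pairWeight-αβ-≢β : ∀ w {u v x y} → y ≢ β → pairWeight-αβ w (u , x) (v , y) ≡ ε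
      pairWeight-αβ-≢β w {x = x} {y} y≢β rewrite dec-false (y ≟⁺ β) y≢β with does (x ≟⁺ α)
      ... | true  = refl
      ... | false = refl

    pairWeight-⇔ : ∀ w {u v x y x′ y′} → value x < value y ⇔ value x′ < value y′ →
                   pairWeight w (u , x) (v , y) ≡ pairWeight w (u , x′) (v , y′)
    pairWeight-⇔ w {u} {v} {x} {y} {x′} {y′} eq =
      cong (λ b → if b then w u v else ε) (does-⇔ eq (value x <? value y) (value x′ <? value y′))

    -- Since `α` and `β` are consecutive, every other letter compares with both in the same way, and
    -- merging them preserves all comparisons except `α` < `β`. The first factor restores that one.
    pairWeight-split : ∀ w p q → pairWeight w p q ≡
                       pairWeight-αβ w p q ∙ pairWeight w (collapseCell p) (collapseCell q)
    pairWeight-split w (u , x) (v , y) = bySplit (x ≟⁺ β) (y ≟⁺ β)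
      where
      value-injective : ∀ {x y} → value x ≡ value y → x ≡ y
      value-injective {1+ _} {1+ _} refl = refl
      combine : ∀ {x′ y′ m₀ m₁ m₂} → pairWeight w (u , x) (v , y) ≡ m₀ → pairWeight-αβ w (u , x) (v , y) ≡ m₁ →
                collapse x ≡ x′ → collapse y ≡ y′ → pairWeight w (u , x′) (v , y′) ≡ m₂ → m₀ ≡ m₁ ∙ m₂ →
                pairWeight w (u , x) (v , y) ≡
                pairWeight-αβ w (u , x) (v , y) ∙ pairWeight w (u , collapse x) (v , collapse y)
      combine e₀ e₁ refl refl e₂ e = trans e₀ (trans e (cong₂ _∙_ (sym e₁) (sym e₂)))
      bySplit : Dec (x ≡ β) → Dec (y ≡ β) → pairWeight w (u , x) (v , y) ≡
                pairWeight-αβ w (u , x) (v , y) ∙ pairWeight w (u , collapse x) (v , collapse y)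
      bySplit (yes refl) (yes refl) = combine (pairWeight-≮ w {x = β} {β} (<-irrefl refl)) (pairWeight-αβ-≢α w (λ ()))
        collapse-β collapse-β (pairWeight-≮ w {x = α} {α} (<-irrefl refl)) (sym (identityˡ _))
      bySplit (yes refl) (no y≢β) = combine refl (pairWeight-αβ-≢α w (λ ())) collapse-β (collapse-other y≢β)
        -- On values, `α` < `y` is by definition `β` ≤ `y`, which is strict because `y` differs from
        -- `β`.
        (pairWeight-⇔ w (mk⇔ (λ α<y → ≤∧≢⇒< α<y (y≢β ∘ value-injective ∘ sym)) <⇒≤)) (sym (identityˡ _))
      bySplit (no x≢β) (no y≢β) = combine refl (pairWeight-αβ-≢β w y≢β) (collapse-other x≢β) (collapse-other y≢β)
        refl (sym (identityˡ _))
      bySplit (no x≢β) (yes refl) = case x ≟⁺ α of λ where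
        (yes refl) → combine (pairWeight-< w {x = α} {β} ≤-refl) (pairWeight-αβ-yes w refl refl) (collapse-other x≢β) collapse-β
          (pairWeight-≮ w {x = α} {α} (<-irrefl refl)) (sym (identityʳ _))
        (no x≢α) → combine refl (pairWeight-αβ-≢α w x≢α) (collapse-other x≢β) collapse-β
          (pairWeight-⇔ w (mk⇔ m<n⇒m<1+n (λ x<β → ≤∧≢⇒< (s≤s⁻¹ x<β) (x≢α ∘ value-injective)))) (sym (identityˡ _))

    pairWeight-αβ-outside : ∀ w {p} q → Outside p → pairWeight-αβ w p q ≡ ε × pairWeight-αβ w q p ≡ ε
    pairWeight-αβ-outside w q (x≢α , x≢β) = pairWeight-αβ-≢α w x≢α , pairWeight-αβ-≢β w x≢β

    pairWeight-αβ-decode : ∀ w p q → pairWeight-αβ w (decode p) (decode q) ≡ pairWeight₂ w p q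
    pairWeight-αβ-decode w (u , false) (v , true)  = pairWeight-αβ-yes w refl refl
    pairWeight-αβ-decode w (u , false) (v , false) = pairWeight-αβ-≢β w (λ ())
    pairWeight-αβ-decode w (u , true)  (v , y)     = pairWeight-αβ-≢α w (λ ())

    collapse-decode : ∀ p → collapseCell (decode p) ≡ (proj₁ p , α)
    collapse-decode (p , true)  = cong (p ,_) collapse-β
    collapse-decode (p , false) = cong (p ,_) (collapse-other (λ ()))

    -- The second factor involves only `φ` and the leftover cells, not the letters that `τ` gives
    -- them. For fixed `φ` and `fs` the statistic is thus the two-letter statistic shifted by a
    -- constant.
    stat-split : ∀ w φ {fs} τ → All Outside φ → map proj₁ τ ≡ fs →
                 stat w (φ ++ map decode τ) ≡ stat₂ w τ ∙ stat w (map collapseCell φ ++ map (_, α) fs)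
    stat-split w φ τ φ-out refl = begin
      stat w σ
        ≡⟨ pairSum-cong σ (λ {p} {q} _ _ → pairWeight-split w p q) ⟩
      pairSum (λ p q → pairWeight-αβ w p q ∙ pairWeight w (collapseCell p) (collapseCell q)) σ
        ≡⟨ pairSum-∙ _ _ σ ⟩
      pairSum (pairWeight-αβ w) σ ∙ pairSum (λ p q → pairWeight w (collapseCell p) (collapseCell q)) σ
        ≡⟨ cong₂ _∙_ two rest ⟩
      stat₂ w τ ∙ stat w (map collapseCell φ ++ map (_, α) (map proj₁ τ)) ∎
      where
      open ≡-Reasoning
      σ : Assignment X ℤ⁺
      σ = φ ++ map decode τ
      two : pairSum (pairWeight-αβ w) σ ≡ stat₂ w τ
      two = trans (pairSum-drop φ (map decode τ) (λ q p∈ → pairWeight-αβ-outside w q (All.lookup φ-out p∈)))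
        (trans (pairSum-map decode _ τ) (pairSum-cong τ (λ {p} {q} _ _ → pairWeight-αβ-decode w p q)))
      rest : pairSum (λ p q → pairWeight w (collapseCell p) (collapseCell q)) σ ≡
             stat w (map collapseCell φ ++ map (_, α) (map proj₁ τ))
      rest = trans (sym (pairSum-map collapseCell _ σ)) (cong (stat w)
        (trans (map-++ collapseCell φ (map decode τ)) (cong (map collapseCell φ ++_)
          (trans (sym (map-∘ τ)) (trans (map-cong collapse-decode τ) (map-∘ τ))))))

    content : List ℤ⁺ → ℕ → ℕ → Monomial
    content xs m n = xs ++ replicate m α ++ replicate n β

    content-decode : ∀ φ τ → map proj₂ (φ ++ map decode τ) ↭ content (map proj₂ φ) (#false τ) (#true τ)
    content-decode φ τ = ↭-trans (↭-reflexive (map-++ proj₂ φ (map decode τ))) (++⁺ˡ (map proj₂ φ) (go τ))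
      where
      go : ∀ τ → map proj₂ (map decode τ) ↭ replicate (#false τ) α ++ replicate (#true τ) β
      go []                = ↭-refl
      go ((_ , false) ∷ τ) = prep α (go τ)
      go ((_ , true)  ∷ τ) =
        ↭-trans (prep β (go τ)) (↭-sym (shift β (replicate (#false τ) α) (replicate (#true τ) β)))

    content-swap : ∀ {xs} → All (λ x → x ≢ α × x ≢ β) xs → ∀ m n →
                   map (transpose α β) (content xs m n) ↭ content xs n m
    content-swap {xs} out m n = ↭-trans (↭-reflexive (begin
      map s (xs ++ replicate m α ++ replicate n β)
        ≡⟨ map-++ s xs _ ⟩
      map s xs ++ map s (replicate m α ++ replicate n β)
        ≡⟨ cong₂ _++_ (trans (map-cong-local (All.map (λ (x≢α , x≢β) → transpose-other x≢α x≢β) out)) (map-id xs))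
             (map-++ s (replicate m α) _) ⟩
      xs ++ map s (replicate m α) ++ map s (replicate n β)
        ≡⟨ cong (xs ++_) (cong₂ _++_ (map-replicate s m α) (map-replicate s n β)) ⟩
      xs ++ replicate m (s α) ++ replicate n (s β)
        ≡⟨ cong (xs ++_) (cong₂ (λ x y → replicate m x ++ replicate n y) (transpose-left α β) (transpose-right α β)) ⟩
      xs ++ replicate m β ++ replicate n α ∎))
      (++⁺ˡ xs (++-comm (replicate m β) (replicate n α)))
      where
      open ≡-Reasoning
      s = transpose α β

    -- The alphabet is `1+ 0`, ..., `1+ (N - 1)`, so `suc a < N` is what puts `β`, and with it `α`,
    -- into it.
    splitLetters : ∀ {N} → suc a < N → ∃[ L ] map 1+_ (upTo N) ↭ α ∷ β ∷ L × All (λ x → x ≢ α × x ≢ β) L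
    splitLetters {N} a<N
      with L , L↭ ← split₂ {v = β} (∈-map⁺ 1+_ (∈-upTo⁺ (<⇒≤ a<N))) (∈-map⁺ 1+_ (∈-upTo⁺ a<N)) (λ ())
      with Unique-resp-↭ (setoid ℤ⁺) (↭⇒↭ₛ L↭) (Unique.map⁺ (cong ℤ⁺.pred) (Unique.upTo⁺ N))
    ... | (_ ∷ α≢L) ∷ β≢L ∷ _ = L , L↭ , All.zipWith (λ (α≢x , β≢x) → α≢x ∘ sym , β≢x ∘ sym) (α≢L , β≢L)

    -- The other letters are placed first. The transposition fixes them, and on the leftover cells
    -- it exchanges the two letter counts up to order. The hypothesis ranges over all sublists
    -- because any cells may be left over.
    adjacent-symmetric : ∀ {w ps N} → (∀ {fs} → fs ⊆ ps → Symmetric₂ w fs) → suc a < N →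
      ∀ (f : M → Monomial → ℕ) → (∀ m {v v′} → v ↭ v′ → f m v ≡ f m v′) →
      assignmentSum (map 1+_ (upTo N)) ps (λ σ → f (stat w σ) (map proj₂ σ)) ≡
      assignmentSum (map 1+_ (upTo N)) ps (λ σ → f (stat w σ) (map (transpose α β) (map proj₂ σ)))
    adjacent-symmetric {w} {ps} S a<N f f-cong with L , L↭ , out ← splitLetters a<N =
      trans (assignmentSum-letters-↭ L↭ ps _) (trans
        (reduce-to-two out ps
          (λ σ↭τ → trans (f-cong _ (map⁺ proj₂ σ↭τ)) (cong (λ m → f m _) (pairSum-↭ _ σ↭τ)))
          (λ σ↭τ → trans (f-cong _ (map⁺ s (map⁺ proj₂ σ↭τ))) (cong (λ m → f m _) (pairSum-↭ _ σ↭τ)))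
          two)
        (sym (assignmentSum-letters-↭ L↭ ps _)))
      where
      s = transpose α β
      two : ∀ φ fs → All Outside φ → fs ⊆ ps →
            assignmentSum letters₂ fs (λ τ → f (stat w (φ ++ map decode τ)) (map proj₂ (φ ++ map decode τ))) ≡
            assignmentSum letters₂ fs (λ τ → f (stat w (φ ++ map decode τ)) (map s (map proj₂ (φ ++ map decode τ))))
      two φ fs φ-out fs⊆ = trans
        (assignmentSum-cong letters₂ fs (λ τ eq →
          trans (f-cong _ (content-decode φ τ)) (cong (λ m → f m _) (stat-split w φ τ φ-out eq))))
        (trans (S fs⊆ (λ m i j → f (m ∙ stat w (map collapseCell φ ++ map (_, α) fs)) (content (map proj₂ φ) i j)))
          (assignmentSum-cong letters₂ fs (λ τ eq → sym (
            trans (f-cong _ (↭-trans (map⁺ s (content-decode φ τ)) (content-swap (outside φ-out) (#false τ) (#true τ))))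
              (cong (λ m → f m _) (stat-split w φ τ φ-out eq))))))
        where
        outside : ∀ {φ} → All Outside φ → All (λ x → x ≢ α × x ≢ β) (map proj₂ φ)
        outside []       = []
        outside (p ∷ ps) = p ∷ outside ps

-- Enumeration of fillings and of cells

-- South is defined through a local function lower which is not in scope here
-- and on which South μ (i , r) is stuck when i is a variable.  The monoid
-- solver is used to get hold of it: in the monoid with operation maybe just it
-- reifies South (oneColumn r) (zero , r), which unfolds to maybe _ nothing
-- (lower r), and the relation of that monoid is chosen such that the proof
-- returned by the solver computes to lower r.  This also describes South for
-- other partitions and columns, as lower does not depend on these.  The field
-- relevant only serves to let x and y be inferred from Reified x y.
record Reified {h : ℕ} (x y : Maybe (Fin h)) : Set where
  constructor reified
  field
    term     : Maybe (Fin h)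
    relevant : x ≡ y → x ≡ y

data Lock : Set where
  unlocked : Lock

-- For a variable l this is a neutral type which ignores its explicit arguments,
-- but from which the solver can still read them off.
Reify : (h : ℕ) (l : Lock) {x y : Maybe (Fin h)} {A : Set} → A → A → Set
Reify h unlocked {x} {y} _ _ = Reified x y

reifyingMonoid : ℕ → Lock → Monoid 0ℓ 0ℓ
reifyingMonoid h l = record
  { Carrier  = Maybe (Fin h)
  ; _≈_      = λ x y → Reify h l {x} {y} x y
  ; _∙_      = maybe just
  ; ε        = nothing
  ; isMonoid = record
    { isSemigroup = record
      { isMagma = record
        { isEquivalence = record { refl = λ {x} → pack l x ; sym = flip l ; trans = first l }
        ; ∙-cong        = λ _ _ → pack l nothing
        }
      ; assoc = λ _ _ _ → pack l nothing
      }
    ; identity = (λ x → pack l x) , (λ x → pack l x)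
    }
  }
  where
  pack : ∀ l {x y : Maybe (Fin h)} → Maybe (Fin h) → Reify h l {x} {y} x y
  pack unlocked m = reified m id
  flip : ∀ l {x y : Maybe (Fin h)} → Reify h l {x} {y} x y → Reify h l {y} {x} y x
  flip unlocked p = reified (Reified.term p) id
  first : ∀ l {x y z : Maybe (Fin h)} →
          Reify h l {x} {y} x y → Reify h l {y} {z} y z → Reify h l {x} {z} x z
  first unlocked p _ = reified (Reified.term p) id

oneColumn : ∀ {h} → Fin h → Partition
oneColumn {h} r = record { parts = h ∷ [] ; decreasing = [-] ; positive = ≤-<-trans z≤n (Fin.toℕ<n r) ∷ [] }

reifyLower : ∀ l {h} (r : Fin h) →
             Reify h l {_} {_} (South (oneColumn r) (zero , r)) (South (oneColumn r) (zero , r))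
reifyLower l {h} r = MonoidSolver.solve (reifyingMonoid h l)

lower : ∀ {h} → Fin h → Maybe (Fin h)
lower zero    = nothing
lower (suc s) = just (inject₁ s)

reifyLower-lower : ∀ {h} (r : Fin h) → Reified.term (reifyLower unlocked r) ≡ lower r
reifyLower-lower zero    = refl
reifyLower-lower (suc _) = refl

South-lower : ∀ μ i r → South μ (i , r) ≡ mapMaybe (i ,_) (lower r)
South-lower μ i r = cong (mapMaybe (i ,_)) (reifyLower-lower r)

lower-spec : ∀ {h} (r : Fin h) →
             (lower r ≡ nothing × toℕ r ≡ 0) ⊎ ∃[ s ] lower r ≡ just s × suc (toℕ s) ≡ toℕ r
lower-spec zero    = inj₁ (refl , refl)
lower-spec (suc s) = inj₂ (inject₁ s , refl , cong suc (Fin.toℕ-inject₁ s))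

-- Indicators and sums over cells

indicator : Bool → ℕ
indicator b = if b then 1 else 0

⟦_⟧ : {P : Set} → Dec P → ℕ
⟦ P? ⟧ = indicator (does P?)

⟦⟧-yes : ∀ {P : Set} (P? : Dec P) → P → ⟦ P? ⟧ ≡ 1
⟦⟧-yes P? p = cong indicator (dec-true P? p)

⟦⟧-no : ∀ {P : Set} (P? : Dec P) → ¬ P → ⟦ P? ⟧ ≡ 0
⟦⟧-no P? ¬p = cong indicator (dec-false P? ¬p)

module _ {A : Set} where

  length-filter : ∀ {P : A → Set} (P? : Decidable P) xs → length (filter P? xs) ≡ ∑ℕ xs (λ x → ⟦ P? x ⟧)
  length-filter P? []       = refl
  length-filter P? (x ∷ xs) with does (P? x)
  ... | true  = cong suc (length-filter P? xs)
  ... | false = length-filter P? xs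

  ∑-filter : ∀ {P : A → Set} (P? : Decidable P) (f : A → ℕ) xs →
             ∑ℕ (filter P? xs) f ≡ ∑ℕ xs (λ x → ⟦ P? x ⟧ * f x)
  ∑-filter P? f []       = refl
  ∑-filter P? f (x ∷ xs) with does (P? x)
  ... | true  = cong₂ _+_ (sym (+-identityʳ (f x))) (∑-filter P? f xs)
  ... | false = ∑-filter P? f xs

  sum-map : ∀ (f : A → ℕ) xs → sum (map f xs) ≡ ∑ℕ xs f
  sum-map f []       = refl
  sum-map f (x ∷ xs) = cong (f x +_) (sum-map f xs)

  ∑-*ˡ : ∀ c (f : A → ℕ) xs → ∑ℕ xs (λ x → c * f x) ≡ c * ∑ℕ xs f
  ∑-*ˡ c f []       = sym (*-zeroʳ c)
  ∑-*ˡ c f (x ∷ xs) = trans (cong (c * f x +_) (∑-*ˡ c f xs)) (sym (*-distribˡ-+ c (f x) _))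

  ∑-single : ∀ {f : A → ℕ} {xs x} → Unique xs → x ∈ xs → (∀ {y} → y ≢ x → f y ≡ 0) → ∑ℕ xs f ≡ f x
  ∑-single {f} (x≢xs ∷ _) (here {xs = xs} refl) f≡0 =
    trans (cong (f _ +_) (∑ℕ-0 xs (λ y∈ → f≡0 (All.lookup x≢xs y∈ ∘ sym)))) (+-identityʳ _)
  ∑-single {f} (y≢xs ∷ xs!) (there x∈) f≡0 =
    cong₂ _+_ (f≡0 (All.lookup y≢xs x∈)) (∑-single xs! x∈ f≡0)

∑-cartesianProductWith : ∀ {A B C : Set} (g : A → B → C) (f : C → ℕ) xs ys →
                         ∑ℕ (cartesianProductWith g xs ys) f ≡ ∑ℕ xs (λ x → ∑ℕ ys (λ y → f (g x y)))
∑-cartesianProductWith g f []       ys = refl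
∑-cartesianProductWith g f (x ∷ xs) ys = trans (∑ℕ-++ f (map (g x) ys) _)
  (cong₂ _+_ (∑ℕ-map (g x) f ys) (∑-cartesianProductWith g f xs ys))

-- The labels `e` are arbitrary so that the induction can pass to `e ∘ suc`; `tables-sum` does the
-- same with the columns.
columns-sum : ∀ {X : Set} L h (e : Fin h → X) (H : Assignment X ℤ⁺ → ℕ) →
              ∑ℕ (columns L h) (λ c → H (tabulate (λ r → e r , lookup c r))) ≡ assignmentSum L (tabulate e) H
columns-sum L zero    e H = +-identityʳ _
columns-sum L (suc h) e H = trans (∑-cartesianProductWith _∷_ _ L (columns L h))
  (∑ℕ-cong L (λ {x} _ → columns-sum L h (e ∘ suc) (λ σ → H ((e zero , x) ∷ σ))))

tables-sum : ∀ {X : Set} {k} L (hs : Vec ℕ k) (e : ∀ i → Fin (lookup hs i) → X) (H : Assignment X ℤ⁺ → ℕ) →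
  ∑ℕ (tables L hs) (λ T → H (concat (tabulate λ i → tabulate λ r → e i r , lookup (lookup⁺ T i) r))) ≡
  assignmentSum L (concat (tabulate λ i → tabulate (e i))) H
tables-sum L []       e H = +-identityʳ _
tables-sum L (h ∷ hs) e H = begin
  ∑ℕ (tables L (h ∷ hs)) (λ T → H (concat (tabulate λ i → tabulate λ r → e i r , lookup (lookup⁺ T i) r)))
    ≡⟨ ∑-cartesianProductWith _∷_ _ (columns L h) (tables L hs) ⟩
  ∑ℕ (columns L h) (λ c → ∑ℕ (tables L hs) (λ T → H (first c ++ concat (tabulate λ i → tabulate λ r → e (suc i) r , lookup (lookup⁺ T i) r))))
    ≡⟨ ∑ℕ-cong (columns L h) (λ {c} _ → tables-sum L hs (λ i → e (suc i)) (λ τ → H (first c ++ τ))) ⟩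
  ∑ℕ (columns L h) (λ c → assignmentSum L others (λ τ → H (first c ++ τ)))
    ≡⟨ columns-sum L h (e zero) (λ σ → assignmentSum L others (λ τ → H (σ ++ τ))) ⟩
  assignmentSum L (tabulate (e zero)) (λ σ → assignmentSum L others (λ τ → H (σ ++ τ)))
    ≡⟨ assignmentSum-++ L (tabulate (e zero)) others H ⟨
  assignmentSum L (tabulate (e zero) ++ others) H ∎
  where
  open ≡-Reasoning
  first  = λ (c : Vec ℤ⁺ h) → tabulate (λ r → e zero r , lookup c r)
  others = concat (tabulate λ i → tabulate (e (suc i)))

module _ (μ : Partition) where

  dg-tabulate : dg μ ≡ concat (tabulate λ i → tabulate (i ,_))
  dg-tabulate = cong concat (trans (map-tabulate _ _) (tabulate-cong (λ i → map-tabulate _ (i ,_))))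

  ∈-dg : ∀ u → u ∈ dg μ
  ∈-dg (i , r) = ∈-concat⁺′ (∈-map⁺ (i ,_) (∈-allFin r)) (∈-map⁺ _ (∈-allFin i))

  dg-unique : Unique (dg μ)
  dg-unique = Unique.concat⁺
    (All.map⁺ (All.universal (λ i → Unique.map⁺ (λ { refl → refl }) (Unique.allFin⁺ _)) _))
    (AllPairs.map⁺ (AllPairs.map disjoint (Unique.allFin⁺ (numParts μ))))
    where
    column : ∀ {u : Cell μ} {i} {rs : List (Fin (lookup (parts μ) i))} → u ∈ map (i ,_) rs → proj₁ u ≡ i
    column u∈ with _ , _ , refl ← ∈-map⁻ _ u∈ = refl
    disjoint : ∀ {i j} → i ≢ j → Disjoint (map (i ,_) (allFin (lookup (parts μ) i))) (map (j ,_) (allFin (lookup (parts μ) j)))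
    disjoint i≢j (u∈i , u∈j) = i≢j (trans (sym (column u∈i)) (column u∈j))

  toAssignment : Filling μ → Assignment (Cell μ) ℤ⁺
  toAssignment T = map (λ u → u , _at_ μ T u) (dg μ)

  fillings-sum : ∀ L (H : Assignment (Cell μ) ℤ⁺ → ℕ) →
                 ∑ℕ (tables L (parts μ)) (H ∘ toAssignment) ≡ assignmentSum L (dg μ) H
  fillings-sum L H = begin
    ∑ℕ (tables L (parts μ)) (H ∘ toAssignment)
      ≡⟨ ∑ℕ-cong (tables L (parts μ)) (λ {T} _ → cong H (begin
        map (λ u → u , _at_ μ T u) (dg μ)
          ≡⟨ cong (map _) dg-tabulate ⟩
        map (λ u → u , _at_ μ T u) (concat (tabulate λ i → tabulate (i ,_)))
          ≡⟨ concat-map (tabulate λ i → tabulate (i ,_)) ⟨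
        concat (map (map (λ u → u , _at_ μ T u)) (tabulate λ i → tabulate (i ,_)))
          ≡⟨ cong concat (trans
            (map-tabulate (λ i → tabulate (i ,_)) (map (λ u → u , _at_ μ T u)))
            (tabulate-cong {n = numParts μ} (λ i → map-tabulate {n = lookup (parts μ) i} (i ,_) (λ u → u , _at_ μ T u)))) ⟩
        concat (tabulate λ i → tabulate λ r → (i , r) , lookup (lookup⁺ T i) r) ∎)) ⟩
    ∑ℕ (tables L (parts μ)) (λ T → H (concat (tabulate λ i → tabulate λ r → (i , r) , lookup (lookup⁺ T i) r)))
      ≡⟨ tables-sum L (parts μ) _,_ H ⟩
    assignmentSum L (concat (tabulate λ i → tabulate (i ,_))) H
      ≡⟨ cong (λ ps → assignmentSum L ps H) dg-tabulate ⟨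
    assignmentSum L (dg μ) H ∎
    where open ≡-Reasoning

  above? : ∀ u v → Dec (suc (row μ u) ≡ row μ v × col μ u ≡ col μ v)
  above? u v = (suc (row μ u) ≟ row μ v) ×-dec (col μ u Fin.≟ col μ v)

  cell-≡ : ∀ {u v : Cell μ} → col μ u ≡ col μ v → row μ u ≡ row μ v → u ≡ v
  cell-≡ {i , r} {.i , r′} refl eq = cong (i ,_) (Fin.toℕ-injective (suc-injective eq))

  row≤ : ∀ (u : Cell μ) → row μ u ≤ lookup (parts μ) (col μ u)
  row≤ (i , r) = Fin.toℕ<n r

  ∑-delta : ∀ {P : Cell μ → Set} (P? : Decidable P) (F : Cell μ → ℕ) {u?} →
            (∀ {u} → u? ≡ just u → P u) → (∀ {v} → P v → u? ≡ just v) →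
            ∑ℕ (dg μ) (λ v → ⟦ P? v ⟧ * F v) ≡ maybe′ F 0 u?
  ∑-delta P? F {nothing} u?⇒P P⇒u? =
    ∑ℕ-0 (dg μ) (λ {v} _ → cong (_* F v) (⟦⟧-no (P? v) (λ p → case P⇒u? p of λ ())))
  ∑-delta P? F {just u} u?⇒P P⇒u? = trans
    (∑-single dg-unique (∈-dg u) (λ {v} v≢u → cong (_* F v) (⟦⟧-no (P? v) (λ p → case P⇒u? p of λ { refl → v≢u refl }))))
    (trans (cong (_* F u) (⟦⟧-yes (P? u) (u?⇒P refl))) (*-identityˡ (F u)))

  -- At most one cell lies above `u`, so the partial functions `North` and `South` can be written as
  -- sums over all cells. In this form the order of summation can be exchanged, which turns sums
  -- over triples into sums over pairs.
  ∑-North : ∀ u F → ∑ℕ (dg μ) (λ v → ⟦ above? u v ⟧ * F v) ≡ maybe′ F 0 (North μ u)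
  ∑-North u@(i , r) F with suc (toℕ r) <? lookup (parts μ) i
  ... | yes r+1<h = ∑-delta (above? u) F
    (λ { refl → cong suc (sym (Fin.toℕ-fromℕ< r+1<h)) , refl })
    (λ { {v} (row≡ , refl) → cong just (cell-≡ refl (trans (cong suc (Fin.toℕ-fromℕ< r+1<h)) row≡)) })
  ... | no  r+1≮h = ∑-delta (above? u) F {nothing} (λ ())
    (λ { {v} (row≡ , refl) → ⊥-elim (r+1≮h (subst (_≤ lookup (parts μ) i) (sym row≡) (row≤ v))) })

  ∑-South : ∀ v F → ∑ℕ (dg μ) (λ u → ⟦ above? u v ⟧ * F u) ≡ maybe′ F 0 (South μ v)
  ∑-South v@(i , r) F rewrite South-lower μ i r with lower-spec r
  ... | inj₁ (eq , r≡0) rewrite eq = ∑-delta (λ u → above? u v) F {nothing} (λ ())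
    (λ (row≡ , _) → case trans (suc-injective row≡) r≡0 of λ ())
  ... | inj₂ (s , eq , s+1≡r) rewrite eq = ∑-delta (λ u → above? u v) F
    (λ { refl → cong suc s+1≡r , refl })
    (λ { {u} (row≡ , refl) → cong just (cell-≡ refl (trans s+1≡r (sym (suc-injective row≡)))) })

-- maj and quinv as sums over pairs of cells

-- If `b < a`, at least one of `b < c` and `c < a` holds, and both exactly when `b < c < a`, the
-- only quinv case then possible. If `a ≤ b`, at most one of them holds, and one does exactly in the
-- other quinv cases.
quinv-inversions : ∀ a b c → ⟦ quinvCondition? a b c ⟧ + ⟦ b <? a ⟧ ≡ ⟦ b <? c ⟧ + ⟦ c <? a ⟧
quinv-inversions a b c = byCases (b <? a) (b <? c) (c <? a)
  where
  Q? = quinvCondition? a b c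
  -- The weak inequality `a ≤ b` merges the case `a ≡ b`, `b ≢ c` with two of the strict ones,
  -- according to whether `b < c` or `c < b`.
  no-quinv : ¬ (a ≤ b × b < c) → ¬ (b < c × c < a) → ¬ (c < a × a ≤ b) → ¬ QuinvCondition a b c
  no-quinv ¬abc ¬bca ¬cab (inj₁ (a<b , b<c))                  = ¬abc (<⇒≤ a<b , b<c)
  no-quinv ¬abc ¬bca ¬cab (inj₂ (inj₁ bca))                    = ¬bca bca
  no-quinv ¬abc ¬bca ¬cab (inj₂ (inj₂ (inj₁ (c<a , a<b))))     = ¬cab (c<a , <⇒≤ a<b)
  no-quinv ¬abc ¬bca ¬cab (inj₂ (inj₂ (inj₂ (refl , b≢c)))) =
    [ (λ b<c → ¬abc (≤-refl , b<c)) , (λ c<b → ¬cab (c<b , ≤-refl)) ]′ (≢⇒<∨> b≢c)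
    where
    ≢⇒<∨> : b ≢ c → b < c ⊎ c < b
    ≢⇒<∨> b≢c = case <-cmp b c of λ where
      (tri< b<c _ _) → inj₁ b<c
      (tri≈ _ b≡c _) → ⊥-elim (b≢c b≡c)
      (tri> _ _ c<b) → inj₂ c<b
  byCases : (x : Dec (b < a)) (y : Dec (b < c)) (z : Dec (c < a)) → ⟦ Q? ⟧ + ⟦ x ⟧ ≡ ⟦ y ⟧ + ⟦ z ⟧
  byCases (yes b<a) (yes b<c) (yes c<a) = cong (_+ 1) (⟦⟧-yes Q? (inj₂ (inj₁ (b<c , c<a))))
  byCases (yes b<a) (yes b<c) (no  c≮a) = cong (_+ 1) (⟦⟧-no Q? (no-quinv
    (λ (a≤b , _) → ≤⇒≯ a≤b b<a) (λ (_ , c<a) → c≮a c<a) (λ (c<a , _) → c≮a c<a)))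
  byCases (yes b<a) (no  b≮c) (yes c<a) = cong (_+ 1) (⟦⟧-no Q? (no-quinv
    (λ (_ , b<c) → b≮c b<c) (λ (b<c , _) → b≮c b<c) (λ (_ , a≤b) → ≤⇒≯ a≤b b<a)))
  byCases (yes b<a) (no  b≮c) (no  c≮a) = ⊥-elim (c≮a (≤-<-trans (≮⇒≥ b≮c) b<a))
  byCases (no  b≮a) (yes b<c) (yes c<a) = ⊥-elim (b≮a (<-trans b<c c<a))
  byCases (no  b≮a) (yes b<c) (no  c≮a) = cong (_+ 0) (⟦⟧-yes Q?
    ([ (λ a<b → inj₁ (a<b , b<c)) , (λ a≡b → inj₂ (inj₂ (inj₂ (a≡b , <⇒≢ b<c)))) ]′ (m≤n⇒m<n∨m≡n (≮⇒≥ b≮a))))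
  byCases (no  b≮a) (no  b≮c) (yes c<a) = cong (_+ 0) (⟦⟧-yes Q?
    ([ (λ a<b → inj₂ (inj₂ (inj₁ (c<a , a<b)))) , (λ { refl → inj₂ (inj₂ (inj₂ (refl , <⇒≢ c<a ∘ sym))) }) ]′ (m≤n⇒m<n∨m≡n (≮⇒≥ b≮a))))
  byCases (no  b≮a) (no  b≮c) (no  c≮a) = cong (_+ 0) (⟦⟧-no Q? (no-quinv
    (λ (_ , b<c) → b≮c b<c) (λ (b<c , _) → b≮c b<c) (λ (c<a , _) → c≮a c<a)))

module _ (μ : Partition) where

  -- These are the pairs compared by `c < a` in a triple: `u` is its right cell, and `v` is the cell
  -- above its left one.
  diagonal? : ∀ u v → Dec (suc (row μ u) ≡ row μ v × col μ v <ᶠ col μ u)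
  diagonal? u v = (suc (row μ u) ≟ row μ v) ×-dec (col μ v Fin.<? col μ u)

  arm : Cell μ → ℕ
  arm u = ∑ℕ (dg μ) (λ v → ⟦ isTriple? μ (u , v) ⟧)

  -- A descent from `u` up to `v` counts `leg v + 1` in `maj`. Expressed through the lower cell,
  -- this depends on `u` alone, as the weights `c u` in `attack` do.
  leg-above : ∀ {u v} → suc (row μ u) ≡ row μ v × col μ u ≡ col μ v → leg μ v + 1 ≡ leg μ u
  leg-above {i , r} {.i , r′} (row≡ , refl) = begin
    h ∸ suc (toℕ r′) + 1  ≡⟨ +-comm _ 1 ⟩
    1 + (h ∸ suc (toℕ r′)) ≡⟨ +-∸-assoc 1 (Fin.toℕ<n r′) ⟨
    h ∸ toℕ r′             ≡⟨ cong (h ∸_) (suc-injective row≡) ⟨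
    h ∸ suc (toℕ r)        ∎
    where
    open ≡-Reasoning
    h = lookup (parts μ) i

  South-exists : ∀ {u v} → suc (row μ u) ≡ row μ v → maybe′ (λ _ → 1) 0 (South μ v) ≡ 1
  South-exists {v = i , r} row≡ rewrite South-lower μ i r with lower-spec r
  ... | inj₁ (_ , r≡0)    = case trans (suc-injective row≡) r≡0 of λ ()
  ... | inj₂ (_ , eq , _) rewrite eq = refl

  -- The only candidate for `u` is the cell below `v′`. It exists when `v′` is one row above `v`,
  -- and it then lies in the row of `v`, so only the columns remain to be compared.
  ∑-South-triple : ∀ v v′ → ∑ℕ (dg μ) (λ u → ⟦ above? μ u v′ ⟧ * ⟦ isTriple? μ (u , v) ⟧) ≡ ⟦ diagonal? v v′ ⟧
  ∑-South-triple v v′ = byCase (diagonal? v v′)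
    where
    byCase : (d : Dec (suc (row μ v) ≡ row μ v′ × col μ v′ <ᶠ col μ v)) →
             ∑ℕ (dg μ) (λ u → ⟦ above? μ u v′ ⟧ * ⟦ isTriple? μ (u , v) ⟧) ≡ ⟦ d ⟧
    byCase (no ¬diagonal) = ∑ℕ-0 (dg μ) (λ {u} _ → term u (above? μ u v′))
      where
      term : ∀ u (d : Dec (suc (row μ u) ≡ row μ v′ × col μ u ≡ col μ v′)) → ⟦ d ⟧ * ⟦ isTriple? μ (u , v) ⟧ ≡ 0
      term u (no _)              = refl
      term u (yes (row≡ , refl)) = trans (*-identityˡ _)
        (⟦⟧-no (isTriple? μ (u , v)) (λ (row≡′ , col<) → ¬diagonal (trans (cong suc (sym row≡′)) row≡ , col<)))
    byCase (yes (row≡ , col<)) = trans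
      (∑ℕ-cong (dg μ) (λ {u} _ → term u (above? μ u v′)))
      (trans (∑-South μ v′ (λ _ → 1)) (South-exists {v} {v′} row≡))
      where
      term : ∀ u (d : Dec (suc (row μ u) ≡ row μ v′ × col μ u ≡ col μ v′)) → ⟦ d ⟧ * ⟦ isTriple? μ (u , v) ⟧ ≡ ⟦ d ⟧ * 1
      term u (no _)               = refl
      term u (yes (row≡′ , refl)) = cong (1 *_)
        (⟦⟧-yes (isTriple? μ (u , v)) (suc-injective (trans row≡′ (sym row≡)) , col<))

  module _ (T : Filling μ) where

    less : Cell μ → Cell μ → ℕ
    less u v = ⟦ value (_at_ μ T u) <? value (_at_ μ T v) ⟧

    pairs : (Cell μ → Cell μ → ℕ) → ℕ
    pairs g = ∑ℕ (dg μ) (λ u → ∑ℕ (dg μ) (λ v → less u v * g u v))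

    majAt-South : ∀ v → majAt μ T v ≡ maybe′ (λ u → less u v * (leg μ v + 1)) 0 (South μ v)
    majAt-South v with South μ v
    ... | nothing = refl
    ... | just u with value (_at_ μ T u) <? value (_at_ μ T v)
    ...   | yes u<v = sym (trans (cong (_* (leg μ v + 1)) (⟦⟧-yes (value (_at_ μ T u) <? value (_at_ μ T v)) u<v)) (*-identityˡ _))
    ...   | no  u≮v = sym (cong (_* (leg μ v + 1)) (⟦⟧-no (value (_at_ μ T u) <? value (_at_ μ T v)) u≮v))

    maj-pairs : maj μ T ≡ pairs (λ u v → ⟦ above? μ u v ⟧ * leg μ u)
    maj-pairs = begin
      maj μ T
        ≡⟨ sum-map (majAt μ T) (dg μ) ⟩
      ∑ℕ (dg μ) (majAt μ T)
        ≡⟨ ∑ℕ-cong (dg μ) (λ {v} _ → trans (majAt-South v) (sym (∑-South μ v (λ u → less u v * (leg μ v + 1))))) ⟩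
      ∑ℕ (dg μ) (λ v → ∑ℕ (dg μ) (λ u → ⟦ above? μ u v ⟧ * (less u v * (leg μ v + 1))))
        ≡⟨ ∑ℕ-comm (λ v u → ⟦ above? μ u v ⟧ * (less u v * (leg μ v + 1))) (dg μ) (dg μ) ⟩
      ∑ℕ (dg μ) (λ u → ∑ℕ (dg μ) (λ v → ⟦ above? μ u v ⟧ * (less u v * (leg μ v + 1))))
        ≡⟨ ∑ℕ-cong (dg μ) (λ {u} _ → ∑ℕ-cong (dg μ) (λ {v} _ → term u v)) ⟩
      pairs (λ u v → ⟦ above? μ u v ⟧ * leg μ u) ∎
      where
      open ≡-Reasoning
      term : ∀ u v → ⟦ above? μ u v ⟧ * (less u v * (leg μ v + 1)) ≡ less u v * (⟦ above? μ u v ⟧ * leg μ u)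
      term u v = byCase (above? μ u v)
        where
        byCase : (d : Dec (suc (row μ u) ≡ row μ v × col μ u ≡ col μ v)) →
                 ⟦ d ⟧ * (less u v * (leg μ v + 1)) ≡ less u v * (⟦ d ⟧ * leg μ u)
        byCase (yes above) = trans (*-identityˡ _) (cong (less u v *_) (trans (leg-above above) (sym (*-identityˡ _))))
        byCase (no _)      = sym (*-zeroʳ (less u v))

    less-North : ∀ v u → ⟦ value (_at_ μ T v) <? _at₀_ μ T (North μ u) ⟧ ≡
                 ∑ℕ (dg μ) (λ v′ → ⟦ above? μ u v′ ⟧ * less v v′)
    less-North v u = trans (byCase (North μ u)) (sym (∑-North μ u (less v)))
      where
      byCase : ∀ u? → ⟦ value (_at_ μ T v) <? _at₀_ μ T u? ⟧ ≡ maybe′ (less v) 0 u?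
      -- An absent cell has value 0, and no value is less than 0.
      byCase nothing  = refl
      byCase (just _) = refl

    quinv-triples : quinv μ T ≡ ∑ℕ (dg μ) (λ u → ∑ℕ (dg μ) (λ v → ⟦ isTriple? μ (u , v) ⟧ * ⟦ isQuinvTriple? μ T (u , v) ⟧))
    quinv-triples = trans (length-filter (isQuinvTriple? μ T) (triples μ))
      (trans (∑-filter (isTriple? μ) _ (cartesianProduct (dg μ) (dg μ))) (∑-cartesianProductWith _,_ _ (dg μ) (dg μ)))

    -- `quinv-inversions` is summed over all triples. The term for `b < a` does not involve the
    -- third cell, so each descent is counted once for every triple with lower left cell `u`, that
    -- is `arm u` times. The term for `b < c` gives the pairs within a row, and that for `c < a` the
    -- diagonal pairs.
    quinv-pairs : quinv μ T + pairs (λ u v → ⟦ above? μ u v ⟧ * arm u) ≡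
                  pairs (λ u v → ⟦ isTriple? μ (u , v) ⟧ + ⟦ diagonal? u v ⟧)
    quinv-pairs = begin
      quinv μ T + pairs (λ u v → ⟦ above? μ u v ⟧ * arm u)
        ≡⟨ cong₂ _+_ quinv-triples descents ⟩
      ∑∑ (λ u v → tri u v * ⟦ isQuinvTriple? μ T (u , v) ⟧) + ∑∑ (λ u v → tri u v * ⟦ val u <? north u ⟧)
        ≡⟨ ∑∑-+ _ _ ⟨
      ∑∑ (λ u v → tri u v * ⟦ isQuinvTriple? μ T (u , v) ⟧ + tri u v * ⟦ val u <? north u ⟧)
        ≡⟨ ∑∑-cong (λ u v → trans (sym (*-distribˡ-+ (tri u v) _ _)) (trans
             (cong (tri u v *_) (quinv-inversions (north u) (val u) (val v)))
             (*-distribˡ-+ (tri u v) _ _))) ⟩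
      ∑∑ (λ u v → tri u v * less u v + tri u v * ⟦ val v <? north u ⟧)
        ≡⟨ ∑∑-+ _ _ ⟩
      ∑∑ (λ u v → tri u v * less u v) + ∑∑ (λ u v → tri u v * ⟦ val v <? north u ⟧)
        ≡⟨ cong₂ _+_ (∑∑-cong (λ u v → *-comm (tri u v) (less u v))) diagonals ⟩
      pairs tri + pairs (λ u v → ⟦ diagonal? u v ⟧)
        ≡⟨ ∑∑-+ _ _ ⟨
      ∑∑ (λ u v → less u v * tri u v + less u v * ⟦ diagonal? u v ⟧)
        ≡⟨ ∑∑-cong (λ u v → sym (*-distribˡ-+ (less u v) _ _)) ⟩
      pairs (λ u v → tri u v + ⟦ diagonal? u v ⟧) ∎
      where
      open ≡-Reasoning
      D = dg μ
      val north : Cell μ → ℕ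
      val u = value (_at_ μ T u)
      north u = _at₀_ μ T (North μ u)
      tri : Cell μ → Cell μ → ℕ
      tri u v = ⟦ isTriple? μ (u , v) ⟧
      ∑∑ : (Cell μ → Cell μ → ℕ) → ℕ
      ∑∑ g = ∑ℕ D (λ u → ∑ℕ D (g u))
      ∑∑-cong : ∀ {g h} → (∀ u v → g u v ≡ h u v) → ∑∑ g ≡ ∑∑ h
      ∑∑-cong g≡h = ∑ℕ-cong D (λ {u} _ → ∑ℕ-cong D (λ {v} _ → g≡h u v))
      ∑∑-+ : ∀ g h → ∑∑ (λ u v → g u v + h u v) ≡ ∑∑ g + ∑∑ h
      ∑∑-+ g h = trans (∑ℕ-cong D (λ {u} _ → ∑ℕ-+ (g u) (h u) D)) (∑ℕ-+ _ _ D)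
      *-swap : ∀ a b c → a * (b * c) ≡ c * (b * a)
      *-swap = solve 3 (λ a b c → a :* (b :* c) := c :* (b :* a)) refl
        where open +-*-Solver

      descents : pairs (λ u v → ⟦ above? μ u v ⟧ * arm u) ≡ ∑∑ (λ u v → tri u v * ⟦ val u <? north u ⟧)
      descents = ∑ℕ-cong D (λ {u} _ → begin
        ∑ℕ D (λ v → less u v * (⟦ above? μ u v ⟧ * arm u))
          ≡⟨ ∑ℕ-cong D (λ {v} _ → *-swap (less u v) ⟦ above? μ u v ⟧ (arm u)) ⟩
        ∑ℕ D (λ v → arm u * (⟦ above? μ u v ⟧ * less u v))
          ≡⟨ ∑-*ˡ (arm u) _ D ⟩
        arm u * ∑ℕ D (λ v → ⟦ above? μ u v ⟧ * less u v)
          ≡⟨ cong (arm u *_) (less-North u u) ⟨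
        arm u * ⟦ val u <? north u ⟧
          ≡⟨ *-comm (arm u) _ ⟩
        ⟦ val u <? north u ⟧ * arm u
          ≡⟨ ∑-*ˡ ⟦ val u <? north u ⟧ (tri u) D ⟨
        ∑ℕ D (λ v → ⟦ val u <? north u ⟧ * tri u v)
          ≡⟨ ∑ℕ-cong D (λ {v} _ → *-comm ⟦ val u <? north u ⟧ (tri u v)) ⟩
        ∑ℕ D (λ v → tri u v * ⟦ val u <? north u ⟧) ∎)

      diagonals : ∑∑ (λ u v → tri u v * ⟦ val v <? north u ⟧) ≡ pairs (λ u v → ⟦ diagonal? u v ⟧)
      diagonals = begin
        ∑∑ (λ u v → tri u v * ⟦ val v <? north u ⟧)
          ≡⟨ ∑∑-cong (λ u v → trans (cong (tri u v *_) (less-North v u)) (sym (∑-*ˡ (tri u v) _ D))) ⟩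
        ∑∑ (λ u v → ∑ℕ D (λ v′ → tri u v * (⟦ above? μ u v′ ⟧ * less v v′)))
          -- Two exchanges make the sum over `u` innermost, where `∑-South-triple` evaluates it.
          ≡⟨ ∑ℕ-comm _ D D ⟩
        ∑∑ (λ v u → ∑ℕ D (λ v′ → tri u v * (⟦ above? μ u v′ ⟧ * less v v′)))
          ≡⟨ ∑ℕ-cong D (λ _ → ∑ℕ-comm _ D D) ⟩
        ∑∑ (λ v v′ → ∑ℕ D (λ u → tri u v * (⟦ above? μ u v′ ⟧ * less v v′)))
          ≡⟨ ∑∑-cong (λ v v′ → trans
               (∑ℕ-cong D (λ {u} _ → *-swap (tri u v) ⟦ above? μ u v′ ⟧ (less v v′)))
               (trans (∑-*ˡ (less v v′) _ D) (cong (less v v′ *_) (∑-South-triple v v′)))) ⟩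
        pairs (λ u v → ⟦ diagonal? u v ⟧) ∎

-- Symmetry of C

-- Exponents of q and t, the latter split into a positive and a negative part.
ℕ³ : Set
ℕ³ = ℕ × ℕ × ℕ

_⊹_ : ℕ³ → ℕ³ → ℕ³
(a , b , c) ⊹ (a′ , b′ , c′) = a + a′ , b + b′ , c + c′

𝟎 : ℕ³
𝟎 = 0 , 0 , 0

cong₃ : ∀ {a a′ b b′ c c′ : ℕ} → a ≡ a′ → b ≡ b′ → c ≡ c′ → _≡_ {A = ℕ³} (a , b , c) (a′ , b′ , c′)
cong₃ refl refl refl = refl

⊹-isCommutativeMonoid : IsCommutativeMonoid _≡_ _⊹_ 𝟎
⊹-isCommutativeMonoid = record
  { isMonoid = record
    { isSemigroup = record
      { isMagma = record { isEquivalence = isEquivalence ; ∙-cong = cong₂ _⊹_ }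
      ; assoc = λ (a , b , c) (a′ , b′ , c′) (a″ , b″ , c″) → cong₃ (+-assoc a a′ a″) (+-assoc b b′ b″) (+-assoc c c′ c″)
      }
    ; identity = (λ _ → refl) , (λ (a , b , c) → cong₃ (+-identityʳ a) (+-identityʳ b) (+-identityʳ c))
    }
  ; comm = λ (a , b , c) (a′ , b′ , c′) → cong₃ (+-comm a a′) (+-comm b b′) (+-comm c c′)
  }

module S³ = Sums ⊹-isCommutativeMonoid

∑-components : ∀ {A : Set} (f g h : A → ℕ) xs →
               S³.∑ xs (λ x → f x , g x , h x) ≡ (∑ℕ xs f , ∑ℕ xs g , ∑ℕ xs h)
∑-components f g h []       = refl
∑-components f g h (x ∷ xs) = cong ((f x , g x , h x) ⊹_) (∑-components f g h xs)

if-scale : ∀ b x y z → (if b then (x , y , z) else 𝟎) ≡ (indicator b * x , indicator b * y , indicator b * z)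
if-scale false x y z = refl
if-scale true  x y z = sym (cong₃ (*-identityˡ x) (*-identityˡ y) (*-identityˡ z))

-- Reading order of the cells

module _ {k : ℕ} where

  grid-< : ∀ {r r′ i i′} → i < k → r < r′ → r * k + i < r′ * k + i′
  grid-< {r} {r′} {i} {i′} i<k r<r′ = begin-strict
    r * k + i   <⟨ +-monoʳ-< (r * k) i<k ⟩
    r * k + k   ≡⟨ +-comm (r * k) k ⟩
    suc r * k   ≤⟨ *-monoˡ-≤ k r<r′ ⟩
    r′ * k      ≤⟨ m≤m+n (r′ * k) i′ ⟩
    r′ * k + i′ ∎
    where open ≤-Reasoning

  grid-next : ∀ r i → r * k + i + k ≡ suc r * k + i
  grid-next r i = solve 3 (λ k x i → x :+ i :+ k := k :+ x :+ i) refl k (r * k) i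
    where open +-*-Solver

module _ (μ : Partition) where

  private
    k = numParts μ

  -- Every row takes up `k` positions, those above short columns staying vacant. So the cell above
  -- is always exactly `k` later.
  position : Cell μ → ℕ
  position (i , r) = toℕ r * k + toℕ i

  position-injective : ∀ {u v} → position u ≡ position v → u ≡ v
  position-injective {i , r} {j , s} eq = case <-cmp (toℕ r) (toℕ s) of λ where
    (tri< r<s _ _) → ⊥-elim (<-irrefl eq (grid-< (Fin.toℕ<n i) r<s))
    (tri> _ _ s<r) → ⊥-elim (<-irrefl (sym eq) (grid-< (Fin.toℕ<n j) s<r))
    (tri≈ _ r≡s _) → cell-≡ μ
      (Fin.toℕ-injective (+-cancelˡ-≡ (toℕ r * k) _ _ (trans eq (cong (λ x → x * k + toℕ j) (sym r≡s)))))
      (cong suc r≡s)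

  open TwoLetters ⊹-isCommutativeMonoid {Cell μ}
  open Letters ⊹-isCommutativeMonoid {Cell μ}

  -- A descent above `u` multiplies by q to the power `leg μ u` and, by `quinv-pairs`, divides by t
  -- to the power `arm μ u`.
  corner : Cell μ → ℕ³
  corner u = leg μ u , 0 , arm μ u

  cellWeight : ℕ → Weight
  cellWeight B = attack position (0 , 1 , 0) k corner B

  -- A later cell is fewer than `k` positions away if it is further right in the same row or further
  -- left in the next row. Distance `k` means directly above, and all other later cells are farther.
  -- The assumption on `B` ensures that the weight at distance `k` is switched on.
  cellWeight-value : ∀ {B} u v → position u < B → cellWeight B u v ≡
    (⟦ above? μ u v ⟧ * leg μ u , ⟦ isTriple? μ (u , v) ⟧ + ⟦ diagonal? μ u v ⟧ , ⟦ above? μ u v ⟧ * arm μ u)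
  cellWeight-value u@(i , r) v@(j , s) u<B = case <-cmp (toℕ r) (toℕ s) of λ where
      (tri> _ r≢s s<r) → trans (attack-back position _ (<-asym (grid-< (Fin.toℕ<n j) s<r)))
        (sym (none (λ (r+1≡s , _) → <-asym s<r (≤-reflexive (suc-injective r+1≡s)))
                   (λ (r≡s , _) → r≢s (suc-injective r≡s))
                   (λ (r+1≡s , _) → <-asym s<r (≤-reflexive (suc-injective r+1≡s)))))
      (tri≈ _ r≡s _) → sameRow r≡s (toℕ i <? toℕ j)
      (tri< r<s r≢s _) → case m≤n⇒m<n∨m≡n r<s of λ where
        (inj₁ r+1<s) → trans (attack-far position _ (subst (_< position v) (sym (grid-next (toℕ r) (toℕ i))) (grid-< (Fin.toℕ<n i) r+1<s)))
          (sym (none (λ (r+1≡s , _) → <-irrefl (suc-injective r+1≡s) r+1<s)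
                     (λ (r≡s , _) → r≢s (suc-injective r≡s))
                     (λ (r+1≡s , _) → <-irrefl (suc-injective r+1≡s) r+1<s)))
        (inj₂ r+1≡s) → nextRow r+1≡s r≢s (grid-< (Fin.toℕ<n i) r<s) (<-cmp (toℕ j) (toℕ i))
    where
    value′ : ℕ³
    value′ = ⟦ above? μ u v ⟧ * leg μ u , ⟦ isTriple? μ (u , v) ⟧ + ⟦ diagonal? μ u v ⟧ , ⟦ above? μ u v ⟧ * arm μ u

    evaluate : ∀ {a b c} → ⟦ above? μ u v ⟧ ≡ a → ⟦ isTriple? μ (u , v) ⟧ ≡ b → ⟦ diagonal? μ u v ⟧ ≡ c →
               value′ ≡ (a * leg μ u , b + c , a * arm μ u)
    evaluate p q r = cong₃ (cong (_* leg μ u) p) (cong₂ _+_ q r) (cong (_* arm μ u) p)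

    none : ¬ (suc (row μ u) ≡ row μ v × i ≡ j) → ¬ IsTriple μ (u , v) → ¬ (suc (row μ u) ≡ row μ v × j <ᶠ i) → value′ ≡ 𝟎
    none p q r = evaluate (⟦⟧-no (above? μ u v) p) (⟦⟧-no (isTriple? μ (u , v)) q) (⟦⟧-no (diagonal? μ u v) r)

    sameRow : toℕ r ≡ toℕ s → Dec (toℕ i < toℕ j) → cellWeight _ u v ≡ value′
    sameRow r≡s (yes i<j) = trans
      (attack-near position _
        (subst (λ x → position u < x * k + toℕ j) r≡s (+-monoʳ-< (toℕ r * k) i<j))
        (subst (λ x → x * k + toℕ j < position u + k) r≡s
          (subst (toℕ r * k + toℕ j <_) (sym (+-assoc (toℕ r * k) (toℕ i) k))
            (+-monoʳ-< (toℕ r * k) (<-≤-trans (Fin.toℕ<n j) (m≤n+m k (toℕ i)))))))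
      (sym (evaluate (⟦⟧-no (above? μ u v) λ (eq , _) → 1+n≢n (trans (suc-injective eq) (sym r≡s)))
        (⟦⟧-yes (isTriple? μ (u , v)) (cong suc r≡s , i<j))
        (⟦⟧-no (diagonal? μ u v) λ (eq , _) → 1+n≢n (trans (suc-injective eq) (sym r≡s)))))
    sameRow r≡s (no i≮j) = trans
      (attack-back position _ λ u<v →
        i≮j (+-cancelˡ-< (toℕ r * k) _ _ (subst (λ x → position u < x * k + toℕ j) (sym r≡s) u<v)))
      (sym (none (λ (eq , _) → 1+n≢n (trans (suc-injective eq) (sym r≡s))) (λ (_ , i<j) → i≮j i<j)
                 (λ (eq , _) → 1+n≢n (trans (suc-injective eq) (sym r≡s)))))

    nextRow : suc (toℕ r) ≡ toℕ s → toℕ r ≢ toℕ s → position u < position v →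
              Tri (toℕ j < toℕ i) (toℕ j ≡ toℕ i) (toℕ j > toℕ i) → cellWeight _ u v ≡ value′
    nextRow r+1≡s r≢s u<v = byColumn
      where
      next : position u + k ≡ toℕ s * k + toℕ i
      next = trans (grid-next (toℕ r) (toℕ i)) (cong (λ x → x * k + toℕ i) r+1≡s)
      byColumn : Tri (toℕ j < toℕ i) (toℕ j ≡ toℕ i) (toℕ j > toℕ i) → cellWeight _ u v ≡ value′
      byColumn (tri< j<i j≢i _) = trans
        (attack-near position _ u<v (subst (position v <_) (sym next) (+-monoʳ-< (toℕ s * k) j<i)))
        (sym (evaluate (⟦⟧-no (above? μ u v) λ (_ , i≡j) → j≢i (cong toℕ (sym i≡j)))
          (⟦⟧-no (isTriple? μ (u , v)) λ (eq , _) → r≢s (suc-injective eq))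
          (⟦⟧-yes (diagonal? μ u v) (cong suc r+1≡s , j<i))))
      byColumn (tri≈ j≮i j≡i _) = trans
        (attack-at position _ u<v (trans (cong (toℕ s * k +_) j≡i) (sym next)) u<B)
        (trans (cong₃ (sym (*-identityˡ (leg μ u))) refl (sym (*-identityˡ (arm μ u))))
          (sym (evaluate (⟦⟧-yes (above? μ u v) (cong suc r+1≡s , Fin.toℕ-injective (sym j≡i)))
            (⟦⟧-no (isTriple? μ (u , v)) λ (eq , _) → r≢s (suc-injective eq))
            (⟦⟧-no (diagonal? μ u v) λ (_ , j<i) → j≮i j<i))))
      byColumn (tri> j≮i j≢i i<j) = trans
        (attack-far position _ (subst (_< position v) (sym next) (+-monoʳ-< (toℕ s * k) i<j)))
        (sym (none (λ (_ , i≡j) → j≢i (cong toℕ (sym i≡j))) (λ (eq , _) → r≢s (suc-injective eq)) (λ (_ , j<i) → j≮i j<i)))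

  stat-filling : ∀ {B} → (∀ {u} → u ∈ dg μ → position u < B) → ∀ T → stat (cellWeight B) (toAssignment μ T) ≡
    ( maj μ T
    , pairs μ T (λ u v → ⟦ isTriple? μ (u , v) ⟧ + ⟦ diagonal? μ u v ⟧)
    , pairs μ T (λ u v → ⟦ above? μ u v ⟧ * arm μ u) )
  stat-filling {B} <B T = begin
    stat (cellWeight B) (toAssignment μ T)
      ≡⟨ S³.pairSum-map (λ u → u , _at_ μ T u) (pairWeight (cellWeight B)) (dg μ) ⟩
    S³.pairSum (λ u v → pairWeight (cellWeight B) (u , _at_ μ T u) (v , _at_ μ T v)) (dg μ)
      ≡⟨ S³.pairSum-cong (dg μ) (λ {u} {v} u∈ _ → trans
           (cong (λ m → if does (value (_at_ μ T u) <? value (_at_ μ T v)) then m else 𝟎) (cellWeight-value u v (<B u∈)))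
           (if-scale (does (value (_at_ μ T u) <? value (_at_ μ T v))) _ _ _)) ⟩
    S³.pairSum triple (dg μ)
      ≡⟨ S³.pairSum-diagonal triple (λ u → cong (λ x → x * _ , x * _ , x * _)
           (⟦⟧-no (value (_at_ μ T u) <? value (_at_ μ T u)) (<-irrefl refl))) (dg μ) ⟩
    S³.∑ (dg μ) (λ u → S³.∑ (dg μ) (triple u))
      ≡⟨ S³.∑-cong (dg μ) (λ {u} _ → ∑-components _ _ _ (dg μ)) ⟩
    S³.∑ (dg μ) _
      ≡⟨ ∑-components _ _ _ (dg μ) ⟩
    (pairs μ T (λ u v → ⟦ above? μ u v ⟧ * leg μ u) , _ , _)
      ≡⟨ cong₃ (sym (maj-pairs μ T)) refl refl ⟩
    (maj μ T , _ , _) ∎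
    where
    open ≡-Reasoning
    triple : Cell μ → Cell μ → ℕ³
    triple u v = less μ T u v * (⟦ above? μ u v ⟧ * leg μ u)
               , less μ T u v * (⟦ isTriple? μ (u , v) ⟧ + ⟦ diagonal? μ u v ⟧)
               , less μ T u v * (⟦ above? μ u v ⟧ * arm μ u)

  bound : ℕ
  bound = proj₁ (bounded position (0 , 1 , 0) (dg μ))

  weight : Weight
  weight = cellWeight bound

  weight-symmetric : ∀ {ps} → ps ⊆ dg μ → Symmetric₂ weight ps
  weight-symmetric ps⊆ = attack-symmetric position (0 , 1 , 0) k corner bound _
    (distinct ps⊆ (AllPairs.map (λ u≢v → u≢v ∘ position-injective) (dg-unique μ)))
    where
    distinct : ∀ {ps qs} → ps ⊆ qs → Distinct position qs → Distinct position ps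
    distinct []          []           = []
    distinct (_ ∷ʳ ps⊆)  (_ ∷ qs!)    = distinct ps⊆ qs!
    distinct (refl ∷ ps⊆) (q≢ ∷ qs!)  = All-resp-⊆ ps⊆ q≢ ∷ distinct ps⊆ qs!

  -- Coefficients as sums over assignments

  term? : ∀ m n w ((a , b , c) : ℕ³) v → Dec (a ≡ m × b ∸ c ≡ n × v ↭ w)
  term? m n w (a , b , c) v = (a ≟ m) ×-dec ((b ∸ c) ≟ n) ×-dec (v ↭? w)

  hasTerm : ℕ → ℕ → Monomial → ℕ³ → Monomial → ℕ
  hasTerm m n w s v = ⟦ term? m n w s v ⟧

  hasTerm-cong : ∀ {m n w} s {v v′} → v ↭ v′ → hasTerm m n w s v ≡ hasTerm m n w s v′
  hasTerm-cong {m} {n} {w} s {v} {v′} v↭v′ = cong indicator (does-⇔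
    (mk⇔ (λ (p , q , v↭w) → p , q , ↭-trans (↭-sym v↭v′) v↭w) (λ (p , q , v′↭w) → p , q , ↭-trans v↭v′ v′↭w))
    (term? m n w s v) (term? m n w s v′))

  hasTerm-filling : ∀ m n w T → ⟦ hasTerm? μ m n w T ⟧ ≡
                    hasTerm m n w (stat weight (toAssignment μ T)) (map proj₂ (toAssignment μ T))
  hasTerm-filling m n w T = begin
    ⟦ hasTerm? μ m n w T ⟧
      ≡⟨ cong (λ x → ⟦ (maj μ T ≟ m) ×-dec (x ≟ n) ×-dec (xMonomial μ T ↭? w) ⟧) quinv≡ ⟩
    hasTerm m n w (maj μ T , inv , des) (xMonomial μ T)
      ≡⟨ cong₂ (hasTerm m n w) (sym (stat-filling (proj₂ (bounded position (0 , 1 , 0) (dg μ))) T)) (map-∘ (dg μ)) ⟩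
    hasTerm m n w (stat weight (toAssignment μ T)) (map proj₂ (toAssignment μ T)) ∎
    where
    open ≡-Reasoning
    inv = pairs μ T (λ u v → ⟦ isTriple? μ (u , v) ⟧ + ⟦ diagonal? μ u v ⟧)
    des = pairs μ T (λ u v → ⟦ above? μ u v ⟧ * arm μ u)
    -- By `quinv-pairs` the subtraction is not truncated on fillings, so `b ∸ c` in `term?` is the
    -- true exponent of t.
    quinv≡ : quinv μ T ≡ inv ∸ des
    quinv≡ = trans (sym (m+n∸n≡m (quinv μ T) des)) (cong (_∸ des) (quinv-pairs μ T))

  coeffUpTo : ℕ → ℕ → ℕ → Monomial → ℕ
  coeffUpTo N m n w = length (filter (hasTerm? μ m n w) (fillingsUpTo N μ))

  coeffUpTo-sum : ∀ N m n w → coeffUpTo N m n w ≡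
    assignmentSum (map 1+_ (upTo N)) (dg μ) (λ σ → hasTerm m n w (stat weight σ) (map proj₂ σ))
  coeffUpTo-sum N m n w = trans (length-filter (hasTerm? μ m n w) (fillingsUpTo N μ))
    (trans (∑ℕ-cong (fillingsUpTo N μ) (λ {T} _ → hasTerm-filling m n w T)) (fillings-sum μ (map 1+_ (upTo N)) _))

  -- Both enumerations are free of repetitions and contain every filling with this term, so a larger
  -- alphabet changes nothing. This allows a common alphabet for a monomial and its image.
  coeffUpTo-coeff : ∀ {N} m n w → maxIndex w ≤ N → coeffUpTo N m n w ≡ coeff (C μ) m n w
  coeffUpTo-coeff {N} m n w w≤N = ↭-length (∼bag⇒↭ (unique∧set⇒bag
    (Unique.filter⁺ (hasTerm? μ m n w) (fillingsUpTo-unique N μ))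
    (Unique.filter⁺ (hasTerm? μ m n w) (fillingsUpTo-unique (maxIndex w) μ))
    (mk⇔ (λ T∈ → complete ≤-refl (proj₂ (∈-filter⁻ (hasTerm? μ m n w) {xs = fillingsUpTo N μ} T∈)))
         (λ T∈ → complete w≤N (proj₂ (∈-filter⁻ (hasTerm? μ m n w) {xs = fillingsUpTo (maxIndex w) μ} T∈))))))
    where
    complete : ∀ {N T} → maxIndex w ≤ N → HasTerm μ m n w T → T ∈ filter (hasTerm? μ m n w) (fillingsUpTo N μ)
    complete {T = T} w≤N term@(_ , _ , T↭w) = ∈-filter⁺ (hasTerm? μ m n w)
      (∈-tables T (λ i r → ∈-map⁺ 1+_ (∈-upTo⁺
        (≤-trans (∈-maxIndex (∈-resp-↭ T↭w (∈-map⁺ (_at_ μ T) (∈-dg μ (i , r))))) w≤N))))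
      term

  -- From adjacent transpositions to all permutations

  Invariance : (ℤ⁺ → ℤ⁺) → Set
  Invariance g = ∀ m n w → coeff (C μ) m n (map g w) ≡ coeff (C μ) m n w

  adjacent-invariance : ∀ a → Invariance (transpose (1+ a) (1+ suc a))
  adjacent-invariance a m n w = begin
    coeff (C μ) m n (map s w)
      ≡⟨ coeffUpTo-coeff m n (map s w) (≤-trans (m≤m⊔n _ _) (m≤m⊔n _ _)) ⟨
    coeffUpTo N m n (map s w)
      ≡⟨ coeffUpTo-sum N m n (map s w) ⟩
    assignmentSum L (dg μ) (λ σ → hasTerm m n (map s w) (stat weight σ) (map proj₂ σ))
      ≡⟨ assignmentSum-cong L (dg μ) (λ σ _ → move (stat weight σ) (map proj₂ σ)) ⟩
    assignmentSum L (dg μ) (λ σ → hasTerm m n w (stat weight σ) (map s (map proj₂ σ)))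
      ≡⟨ adjacent-symmetric a weight-symmetric (m≤n⊔m _ _) (hasTerm m n w) (hasTerm-cong {m} {n} {w}) ⟨
    assignmentSum L (dg μ) (λ σ → hasTerm m n w (stat weight σ) (map proj₂ σ))
      ≡⟨ coeffUpTo-sum N m n w ⟨
    coeffUpTo N m n w
      ≡⟨ coeffUpTo-coeff m n w (≤-trans (m≤n⊔m (maxIndex (map s w)) (maxIndex w)) (m≤m⊔n _ _)) ⟩
    coeff (C μ) m n w ∎
    where
    open ≡-Reasoning
    s = transpose (1+ a) (1+ suc a)
    -- Large enough for both monomials; the last term ensures that the two exchanged letters are in
    -- the alphabet.
    N = maxIndex (map s w) ⊔ maxIndex w ⊔ suc (suc a)
    L = map 1+_ (upTo N)
    ss≡ : ∀ w → map s (map s w) ≡ w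
    ss≡ w = trans (sym (map-∘ w)) (trans (map-cong (transpose-involutive (1+ a) (1+ suc a)) w) (map-id w))
    move : ∀ st v → hasTerm m n (map s w) st v ≡ hasTerm m n w st (map s v)
    move st v = cong indicator (does-⇔ (mk⇔
      (λ (p , q , v↭) → p , q , ↭-trans (map⁺ s v↭) (↭-reflexive (ss≡ w)))
      (λ (p , q , sv↭) → p , q , ↭-trans (↭-reflexive (sym (ss≡ v))) (map⁺ s sv↭)))
      (term? m n (map s w) st v) (term? m n w st (map s v)))

  Invariance-∘ : ∀ {f g} → Invariance f → Invariance g → Invariance (f ∘ g)
  Invariance-∘ {f} {g} inv-f inv-g m n w =
    trans (cong (coeff (C μ) m n) (map-∘ w)) (trans (inv-f m n (map g w)) (inv-g m n w))

  Invariance-cong : ∀ {f g} → (∀ x → f x ≡ g x) → Invariance f → Invariance g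
  Invariance-cong f≡g inv-f m n w = trans (cong (coeff (C μ) m n) (sym (map-cong f≡g w))) (inv-f m n w)

  transpose-invariance : ∀ α β → Invariance (transpose α β)
  transpose-invariance (1+ a) (1+ b) = case <-cmp a b of λ where
      (tri< a<b _ _) → upward (≤⇒≤′ a<b)
      (tri≈ _ refl _) → Invariance-cong (λ x → sym (transpose-trivial (1+ a) x)) (λ m n w → cong (coeff (C μ) m n) (map-id w))
      (tri> _ _ b<a) → Invariance-cong (transpose-sym (1+ b) (1+ a)) (upward (≤⇒≤′ b<a))
    where
    -- The transposition of `a` and `suc b` is that of `a` and `b` conjugated by the adjacent one of
    -- `b` and `suc b`.
    upward : ∀ {a b} → suc a ≤′ b → Invariance (transpose (1+ a) (1+ b))
    upward ≤′-refl = adjacent-invariance _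
    upward {a} (≤′-step {n = b} a<b) = Invariance-cong
      (transpose-conjugate (λ { refl → <-irrefl refl (≤′⇒≤ a<b) }) (λ { refl → <-asym (n<1+n _) (≤′⇒≤ a<b) }) (λ ()))
      (Invariance-∘ (adjacent-invariance b) (Invariance-∘ (upward a<b) (adjacent-invariance b)))

  -- A coefficient sees only the letters of `w`, so it suffices to imitate `π` there by a product of
  -- transpositions. Exchanging `g y` and `π y` corrects the value at `y`. It leaves the other
  -- letters of `w` alone, since injectivity of `g` and of `π` keeps their images away from both;
  -- hence injectivity of `g` is carried along.
  realize : ∀ {π : ℤ⁺ → ℤ⁺} → (∀ {x y} → π x ≡ π y → x ≡ y) → ∀ w →
            ∃[ g ] Invariance g × (∀ {x y} → g x ≡ g y → x ≡ y) × (∀ {x} → x ∈ w → g x ≡ π x)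
  realize π-inj [] = id , (λ m n w → cong (coeff (C μ) m n) (map-id w)) , id , λ ()
  realize {π} π-inj (y ∷ w) with g , inv , g-inj , g≡π ← realize π-inj w =
    s ∘ g , Invariance-∘ (transpose-invariance (g y) (π y)) inv , (λ eq → g-inj (s-inj eq)) , agree
    where
    s = transpose (g y) (π y)
    s-inj : ∀ {x x′} → s x ≡ s x′ → x ≡ x′
    s-inj {x} {x′} eq = trans (sym (transpose-involutive (g y) (π y) x))
      (trans (cong s eq) (transpose-involutive (g y) (π y) x′))
    agree : ∀ {x} → x ∈ y ∷ w → s (g x) ≡ π x
    agree (here refl)    = transpose-left (g y) (π y)
    agree {x} (there x∈) = case x ≟⁺ y of λ where
      (yes refl) → transpose-left (g y) (π y)
      (no x≢y)   → trans
        (transpose-other (x≢y ∘ g-inj) (λ gx≡πy → x≢y (π-inj (trans (sym (g≡π x∈)) gx≡πy))))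
        (g≡π x∈)

  injective-invariance : ∀ {π : ℤ⁺ → ℤ⁺} → (∀ {x y} → π x ≡ π y → x ≡ y) → Invariance π
  injective-invariance π-inj m n w with g , inv , _ , g≡π ← realize π-inj w =
    trans (cong (coeff (C μ) m n) (map-cong-local (All.tabulate (sym ∘ g≡π)))) (inv m n w)

mainTheorem2 : (μ : Partition) → Symmetric (C μ)
-- `permuteVars` applies `Inverse.from π` to the monomial; this map is injective because
-- `Inverse.to π` undoes it.
mainTheorem2 μ π = injective-invariance μ (λ {x} {y} eq →
  trans (sym (Inverse.strictlyInverseˡ π x)) (trans (cong (Inverse.to π) eq) (Inverse.strictlyInverseˡ π y)))
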